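{- Let $q$ be a prime power, let $n,t$ be positive integers, let $s$ be a positive integer with $\gcd(s,n)=1$, and let $\sigma\colon x\mapsto x^{q^s}$, an automorphism of $\mathbb{F}_{q^{nt}}$ (so that $\sigma|_{\mathbb{F}_{q^n}}$ has order $n$). Let $b_0,\dots,b_{t-1}\in\mathbb{F}_{q^{nt}}$ and let \[ f(x)=-x+b_0x^{\sigma}+b_1x^{\sigma q^n}+b_2x^{\sigma q^{2n}}+\cdots+b_{t-1}x^{\sigma q^{n(t-1)}}. \] Let $G(x)=\sum_{i=0}^{t-1}b_ix^{q^{ni}}$, so that $f(x)=(G\circ\sigma)(x)-x$. Then: 1. $\dim_{\mathbb{F}_q}\ker f\le t$; 2. $\ker f=\{0\}$ if and only if $\ker((G\circ\sigma)^n-\mathrm{id})=\{0\}$; 3. more generally, $\dim_{\mathbb{F}_q}\ker f=\dim_{\mathbb{F}_{q^n}}\ker((G\circ\sigma)^n-\mathrm{id})$. In particular, $\dim_{\mathbb{F}_q}\ker f=t$ if and only if $(G\circ\sigma)^n=\mathrm{id}$.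
   Context: Notation: $x^{\sigma q^{ni}}:=x^{q^{s+ni}}$. All polynomials are identified with the maps $\mathbb{F}_{q^{nt}}\to\mathbb{F}_{q^{nt}}$ they induce; $\ker f$ is the set of roots of $f$ in $\mathbb{F}_{q^{nt}}$, an $\mathbb{F}_q$-subspace. $H^n$ denotes the $n$-fold composition $H\circ\cdots\circ H$, and $\mathrm{id}$ is the identity map of $\mathbb{F}_{q^{nt}}$. The map $(G\circ\sigma)^n$ is $\mathbb{F}_{q^n}$-linear on $\mathbb{F}_{q^{nt}}$, so the kernel in item 3 is an $\mathbb{F}_{q^n}$-subspace. -}

module Defs where

open import Algebra.Apartness.Bundles using (HeytingField; HeytingCommutativeRing)
open import Algebra.Bundles using (CommutativeRing)
open import Data.Fin.Base using (Fin; toℕ)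
import Data.Nat.Base as ℕ
open import Data.Nat.Base using (ℕ)
open import Data.Nat.Primality using (Prime)
open import Data.Product.Base using (Σ; ∃; ∃₂; _×_; proj₁)
open import Data.Vec.Functional using (Vector)
open import Function.Bundles using (Inverse; _⇔_)
open import Level using (_⊔_)
open import Relation.Binary.Bundles using (Setoid)
import Relation.Binary.Construct.On as On
open import Relation.Binary.Definitions using (_Respects_)
open import Relation.Binary.PropositionalEquality using (_≡_)
import Relation.Binary.PropositionalEquality.Properties as ≡
open import Relation.Unary using (Pred; _∈_)

IsPrimePower : ℕ → Set
IsPrimePower q = ∃₂ λ p k → Prime p × 1 ℕ.≤ k × q ≡ p ℕ.^ k

HasOrder : ∀ {c ℓ} → Setoid c ℓ → ℕ → Set (c ⊔ ℓ)
HasOrder S m = Inverse S (≡.setoid (Fin m))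

-- HeytingField admits the zero ring, and its inverses are only given for
-- elements apart from 0#.  A finite setoid has decidable equality, so a
-- HeytingField of finite order at least 2 is a finite field in the usual
-- sense: every x ≉ 0# is invertible, and x # y amounts to x ≉ y.
module FieldTheory {c ℓ₁ ℓ₂} (E : HeytingField c ℓ₁ ℓ₂) where

  open HeytingField E
    using (Carrier; _≈_; _+_; _*_; -_; _-_; 0#; 1#; heytingCommutativeRing) public
  open HeytingCommutativeRing heytingCommutativeRing using (commutativeRing)
  open CommutativeRing commutativeRing using (setoid; semiring; +-monoid) public
  open import Algebra.Properties.Semiring.Exp semiring using (_^_) public
  open import Algebra.Properties.Monoid.Sum +-monoid using (sum-syntax) public
  open import Function.Endo.Propositional Carrier using (Endo)
    renaming (_^_ to _^∘_) public

  subsetoid : ∀ {ℓ} → Pred Carrier ℓ → Setoid (c ⊔ ℓ) ℓ₁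
  subsetoid P = On.setoid {B = Σ Carrier P} setoid proj₁

  record IsSubfield {ℓ} (K : Pred Carrier ℓ) : Set (c ⊔ ℓ₁ ⊔ ℓ) where
    field
      resp      : K Respects _≈_
      0∈        : 0# ∈ K
      1∈        : 1# ∈ K
      +-closed  : ∀ {x y} → x ∈ K → y ∈ K → x + y ∈ K
      -‿closed  : ∀ {x} → x ∈ K → - x ∈ K
      *-closed  : ∀ {x y} → x ∈ K → y ∈ K → x * y ∈ K
      ⁻¹-closed : ∀ {x y} → x ∈ K → x * y ≈ 1# → y ∈ K

  IsSubfieldOfOrder : ∀ {ℓ} → Pred Carrier ℓ → ℕ → Set (c ⊔ ℓ₁ ⊔ ℓ)
  IsSubfieldOfOrder K m = IsSubfield K × HasOrder (subsetoid K) m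

  -- IsBasis requires W to equal the span of v, so it can hold only when W
  -- is a K-subspace.
  record IsBasis {ℓ ℓ′ d} (K : Pred Carrier ℓ) (W : Pred Carrier ℓ′)
                 (v : Vector Carrier d) : Set (c ⊔ ℓ₁ ⊔ ℓ ⊔ ℓ′) where
    field
      independent : (a : Vector Carrier d) → (∀ i → a i ∈ K) →
                    ∑[ i < d ] (a i * v i) ≈ 0# → ∀ i → a i ≈ 0#
      spanning    : ∀ x → x ∈ W ⇔
                    (∃ λ (a : Vector Carrier d) → (∀ i → a i ∈ K) × x ≈ ∑[ i < d ] (a i * v i))

  HasDimension : ∀ {ℓ ℓ′} → Pred Carrier ℓ → Pred Carrier ℓ′ → ℕ →
                 Set (c ⊔ ℓ₁ ⊔ ℓ ⊔ ℓ′)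
  HasDimension K W d = ∃ λ (v : Vector Carrier d) → IsBasis K W v

  ker : Endo → Pred Carrier ℓ₁
  ker φ x = φ x ≈ 0#

  σ : (q s : ℕ) → Endo
  σ q s x = x ^ (q ℕ.^ s)

  G : ∀ (q n : ℕ) {t} → Vector Carrier t → Endo
  G q n {t} b x = ∑[ i < t ] (b i * x ^ (q ℕ.^ (n ℕ.* toℕ i)))

  f : ∀ (q n s : ℕ) {t} → Vector Carrier t → Endo
  f q n s {t} b x = - x + ∑[ i < t ] (b i * x ^ (q ℕ.^ (s ℕ.+ n ℕ.* toℕ i)))

{-# OPTIONS --safe #-}
module Submission where

-- Put T = G ∘ σ.  Then ker f is the set of fixed points of T and ker (Φ - id) that of Tⁿ, where T is
-- semilinear over L with respect to a ↦ a^(q^s), whose fixed field in L is K because gcd s n = 1.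
-- This is Galois descent: a K-basis of Fix T is an L-basis of Fix Tⁿ.  It stays independent by Artin's
-- argument (normalise a relation over L, apply T, subtract), and it spans because the traces
-- Σⱼ Tʲ (a v), a ∈ L, of v ∈ Fix Tⁿ lie in Fix T while the characters a ↦ a^(q^(sj)), j < n, of L are
-- independent.  Both dimensions are thus equal, and the bound t comes from counting:
-- an L-independent family of d vectors in E yields (qⁿ)^d ≤ q^(nt) elements.

open import Defs
open import Algebra.Apartness.Bundles using (HeytingField; HeytingCommutativeRing)
open import Algebra.Bundles using (CommutativeMonoid; CommutativeRing)
import Algebra.Properties.CommutativeMonoid.Sum as CommutativeMonoidSum
import Algebra.Properties.CommutativeSemiring.Binomial as Binomial
import Algebra.Properties.CommutativeSemiring.Exp as CommutativeExp
import Algebra.Properties.Ring as RingProperties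
import Algebra.Properties.Semiring.Mult as SemiringMult
import Algebra.Properties.Semiring.Sum as SemiringSum
import Algebra.Solver.Ring.NaturalCoefficients.Default as SemiringSolver
open import Data.Fin.Base using (Fin; zero; suc; toℕ; fromℕ; inject₁; inject≤; punchIn; combine; finToFun; funToFin)
import Data.Fin.Permutation as Permutation
import Data.Fin.Properties as Fin
open import Data.Nat.Base as ℕ using (ℕ; zero; suc; NonZero; _≤_; _<_; _!; z≤n; s≤s)
open import Data.Nat.Combinatorics using (_C_; nCk≡n!/k![n-k]!; k![n∸k]!∣n!; nCn≡1)
open import Data.Nat.Divisibility using (_∣_; divides; ∣⇒≤; m∣m*n)
open import Data.Nat.DivMod using (m/n*n≡m)
open import Data.Nat.GCD using (gcd; gcd-GCD; module Bézout)
open Bézout using (Identity; +-; -+; identity)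
open import Data.Nat.Primality using (Prime; euclidsLemma; prime⇒nonZero; prime⇒nonTrivial)
import Data.Nat.Properties as ℕ
open import Data.Product.Base using (∃; ∃-syntax; _×_; _,_; proj₁; proj₂)
open import Data.Sum.Base using (inj₁; inj₂)
open import Data.Vec.Base as Vec using (Vec; []; _∷_)
open import Data.Vec.Functional using (Vector) renaming (_∷_ to _∷ᵛ_)
open import Function.Base using (_∘_)
open import Function.Bundles using (Inverse; Equivalence; _⇔_; mk⇔)
open import Level using (_⊔_)
open import Relation.Binary.Bundles using (Setoid)
open import Relation.Binary.Definitions using (_Respects_)
open import Relation.Binary.PropositionalEquality as ≡ using (_≡_; _≢_)
import Relation.Binary.Reasoning.Setoid as SetoidReasoning
open import Relation.Nullary using (¬_; Dec; yes; no; contradiction)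
open import Relation.Nullary.Decidable using (map′; decidable-stable)
open import Relation.Unary using (Pred; _∈_; _≐_; Decidable)
open import Relation.Unary.Properties using (≐-sym)

-- Semilinearity has a simple source: the exponents in `G` are powers of q^n, which fix L pointwise,
-- so only σ acts on scalars from L. For arbitrary b, T need not be invertible on E, so no group
-- acts there. On Fix Tⁿ, however, T is a bijection with inverse T^(n-1), and it gives a semilinear
-- action of the cyclic group Gal(L/K). This is the action along which descent takes place. K and L
-- are given only as subfields of orders q and q^n. That K lies in L, and that elements of L fixed
-- by σ lie in K, both follow from identifying a subfield of order m with the roots of X^m - X in E:
-- a product over its elements gives one inclusion, the bound on the number of roots the other.
-- Coprimality of s and n enters twice, for the fixed field and for the distinctness of the n
-- characters. The field axioms provide an apartness only. The enumeration of E makes equality,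
-- membership in subfields and spans decidable, so inverses and bases are found by search.

module _ {p} (p-prime : Prime p) where

  prime∣!⇒≤ : ∀ k → p ∣ k ! → p ≤ k
  prime∣!⇒≤ zero    p∣1 = contradiction (∣⇒≤ p∣1) (ℕ.<⇒≱ (ℕ.nonTrivial⇒n>1 p {{prime⇒nonTrivial p-prime}}))
  prime∣!⇒≤ (suc k) p∣k! with euclidsLemma (suc k) (k !) p-prime p∣k!
  ... | inj₁ p∣k+1 = ∣⇒≤ p∣k+1
  ... | inj₂ p∣k!′ = ℕ.m≤n⇒m≤1+n (prime∣!⇒≤ k p∣k!′)

  -- p divides p! = (p C k) · k! · (p-k)!, but neither factorial, because k and p-k are both below
  -- p.
  prime∣C : ∀ {k} → 0 < k → k < p → p ∣ p C k
  prime∣C {k} 0<k k<p with euclidsLemma (p C k) _ p-prime p∣C*k![p-k]!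
    where
    instance _ = ℕ._!*_!≢0 k (p ℕ.∸ k)
    C*k![p-k]! : (p C k) ℕ.* (k ! ℕ.* (p ℕ.∸ k) !) ≡ p !
    C*k![p-k]! = ≡.trans (≡.cong (ℕ._* (k ! ℕ.* (p ℕ.∸ k) !)) (nCk≡n!/k![n-k]! (ℕ.<⇒≤ k<p)))
                         (m/n*n≡m (k![n∸k]!∣n! (ℕ.<⇒≤ k<p)))
    n∣n! : ∀ n .{{_ : NonZero n}} → n ∣ n !
    n∣n! (suc n) = m∣m*n (n !)
    p∣C*k![p-k]! : p ∣ (p C k) ℕ.* (k ! ℕ.* (p ℕ.∸ k) !)
    p∣C*k![p-k]! = ≡.subst (p ∣_) (≡.sym C*k![p-k]!) (n∣n! p {{prime⇒nonZero p-prime}})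
  ... | inj₁ p∣C = p∣C
  ... | inj₂ p∣k![p-k]! with euclidsLemma (k !) ((p ℕ.∸ k) !) p-prime p∣k![p-k]!
  ...   | inj₁ p∣k!     = contradiction (prime∣!⇒≤ k p∣k!) (ℕ.<⇒≱ k<p)
  ...   | inj₂ p∣[p-k]! =
    contradiction (prime∣!⇒≤ (p ℕ.∸ k) p∣[p-k]!) (ℕ.<⇒≱ (ℕ.∸-monoʳ-< 0<k (ℕ.<⇒≤ k<p)))

-- Finite setoids: search and reindexing

module FiniteSetoid {c ℓ} {S : Setoid c ℓ} {m} (order : HasOrder S m) where
  open Setoid S
  open Inverse order public using (to; from; to-cong)

  from∘to : ∀ x → from (to x) ≈ x
  from∘to x = Inverse.inverseʳ order ≡.refl

  to∘from : ∀ i → to (from i) ≡ i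
  to∘from i = Inverse.inverseˡ order refl

  from-injective : ∀ {i j} → from i ≈ from j → i ≡ j
  from-injective {i} {j} eq = ≡.trans (≡.sym (to∘from i)) (≡.trans (to-cong eq) (to∘from j))

  to-injective : ∀ {x y} → to x ≡ to y → x ≈ y
  to-injective {x} {y} eq = trans (sym (from∘to x)) (trans (reflexive (≡.cong from eq)) (from∘to y))

  infix 4 _≟_

  _≟_ : ∀ x y → Dec (x ≈ y)
  x ≟ y = map′ to-injective to-cong (to x Fin.≟ to y)

  any? : ∀ {ℓ′} {P : Pred Carrier ℓ′} → P Respects _≈_ → Decidable P → Dec (∃ P)
  any? resp P? = map′ (λ (i , p) → from i , p) (λ (x , p) → to x , resp (sym (from∘to x)) p)
                      (Fin.any? (P? ∘ from))

  module _ {c′ ℓ′} (M : CommutativeMonoid c′ ℓ′) where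
    private module M = CommutativeMonoid M
    open CommutativeMonoidSum M using (sum; sum-permute; sum-cong-≋)

    -- Conjugating the bijection by the enumeration turns it into a permutation of indices. The
    -- monoid is arbitrary because both instances occur: sums under translation give `order·x≈0`,
    -- products under scaling give `x^order≈x`.
    sum-reindex : (g : Carrier → M.Carrier) → (∀ {x y} → x ≈ y → g x M.≈ g y) →
                  (π π⁻¹ : Carrier → Carrier) →
                  (∀ {x y} → x ≈ y → π x ≈ π y) → (∀ {x y} → x ≈ y → π⁻¹ x ≈ π⁻¹ y) →
                  (∀ x → π (π⁻¹ x) ≈ x) → (∀ x → π⁻¹ (π x) ≈ x) →
                  sum (g ∘ from) M.≈ sum (g ∘ π ∘ from)
    sum-reindex g g-cong π π⁻¹ π-cong π⁻¹-cong ππ⁻¹ π⁻¹π =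
      M.trans (sum-permute (g ∘ from) perm) (sum-cong-≋ (λ i → g-cong (from∘to (π (from i)))))
      where
      conjugate-inverse : ∀ {π ρ : Carrier → Carrier} → (∀ {x y} → x ≈ y → π x ≈ π y) →
                          (∀ x → π (ρ x) ≈ x) → ∀ i → to (π (from (to (ρ (from i))))) ≡ i
      conjugate-inverse π-cong πρ i =
        ≡.trans (to-cong (trans (π-cong (from∘to _)) (πρ _))) (to∘from i)
      perm = Permutation.permutation (to ∘ π ∘ from) (to ∘ π⁻¹ ∘ from)
        (conjugate-inverse π-cong ππ⁻¹) (conjugate-inverse π⁻¹-cong π⁻¹π)

-- Finite fields

module FiniteField {c ℓ₁ ℓ₂} (E : HeytingField c ℓ₁ ℓ₂) {N} (1<N : 1 < N)
                   (order : HasOrder (FieldTheory.setoid E) N) where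

  open FieldTheory E public
  open HeytingField E using (#⇒invertible; tight)
  open HeytingCommutativeRing heytingCommutativeRing using (commutativeRing)
  open CommutativeRing commutativeRing public
    using ( refl; sym; trans; reflexive; ring; commutativeSemiring
          ; +-cong; +-congˡ; +-congʳ; +-comm; +-identityˡ; +-identityʳ
          ; *-cong; *-congˡ; *-congʳ; *-assoc; *-comm; *-identityˡ; *-identityʳ
          ; -‿cong; -‿inverseˡ; zeroˡ; zeroʳ; distribˡ; distribʳ
          ; *-commutativeMonoid; +-commutativeMonoid; _≉_)
  open RingProperties ring public
    using ( -0#≈0#; -‿distribˡ-*; -‿distribʳ-*; +-cancelˡ; +-cancelʳ; x∙y⁻¹≈ε⇒x≈y; x≈y⇒x∙y⁻¹≈ε
          ; //-rightDividesˡ; //-rightDividesʳ)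
  open SemiringSum semiring public
    using (sum; sum-cong-≋; sum-replicate; sum-replicate-zero; ∑-distrib-+; *-distribˡ-sum
          ; sum-init-last)
  open CommutativeExp commutativeSemiring public
    using (^-congˡ; ^-congʳ; ^-assocʳ; ^-distrib-*)
  open SemiringMult semiring public using (×1-homo-*; ×-assoc-*; ×-homo-1)
    renaming (_×_ to _·_; ×-congʳ to ·-congʳ; ×-congˡ to ·-congˡ)
  open SetoidReasoning setoid public
  open SemiringSolver commutativeSemiring using (solve; _:=_; _:+_; _:*_)
  open Binomial commutativeSemiring using (binomialTerm) renaming (theorem to binomial-theorem)
  open FiniteSetoid order public using (_≟_; any?; from; to; from∘to; from-injective; to-injective; sum-reindex)

  y+[x-y]≈x : ∀ x y → y + (x - y) ≈ x
  y+[x-y]≈x x y = trans (+-comm y (x - y)) (//-rightDividesˡ y x)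

  x-0≈x : ∀ x → x - 0# ≈ x
  x-0≈x x = trans (+-congˡ -0#≈0#) (+-identityʳ x)

  -- The axioms admit the zero ring; it is excluded because the enumeration has at least two indices
  -- and would send all of them to 0.
  1≉0 : 1# ≉ 0#
  1≉0 1≈0 = 0≢1 1<N from-injective
    where
    x≈0 : ∀ x → x ≈ 0#
    x≈0 x = trans (sym (*-identityˡ x)) (trans (*-congʳ 1≈0) (zeroˡ x))
    0≢1 : ∀ {n} {g : Fin n → Carrier} → 1 < n → ¬ (∀ {i j} → g i ≈ g j → i ≡ j)
    0≢1 (s≤s (s≤s _)) g-injective with () ← g-injective {zero} {suc zero} (trans (x≈0 _) (sym (x≈0 _)))

  -- Apartness is not assumed decidable, but invertibility is, by search; an x without inverse is not
  -- apart from 0#, so it equals 0# by tightness.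
  inverse : ∀ {x} → x ≉ 0# → ∃ λ y → x * y ≈ 1#
  inverse {x} x≉0 with any? {P = λ y → x * y ≈ 1#} (λ y≈z → trans (*-congˡ (sym y≈z))) (λ y → x * y ≟ 1#)
  ... | yes xy≈1 = xy≈1
  ... | no ¬inv = contradiction (proj₁ (tight x 0#) x#0⇒⊥) x≉0
    where
    x#0⇒⊥ = λ x#0 → let y , _ , [x-0]y≈1 = #⇒invertible x#0 in
      ¬inv (y , trans (*-congʳ (sym (x-0≈x x))) [x-0]y≈1)

  *-cancelˡ-nonZero : ∀ {x y z} → x ≉ 0# → x * y ≈ x * z → y ≈ z
  *-cancelˡ-nonZero {x} {y} {z} x≉0 xy≈xz with x⁻¹ , xx⁻¹≈1 ← inverse x≉0 = begin
    y              ≈⟨ *-identityˡ y ⟨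
    1# * y         ≈⟨ *-congʳ (trans (sym xx⁻¹≈1) (*-comm x x⁻¹)) ⟩
    (x⁻¹ * x) * y  ≈⟨ *-assoc x⁻¹ x y ⟩
    x⁻¹ * (x * y)  ≈⟨ *-congˡ xy≈xz ⟩
    x⁻¹ * (x * z)  ≈⟨ *-assoc x⁻¹ x z ⟨
    (x⁻¹ * x) * z  ≈⟨ *-congʳ (trans (*-comm x⁻¹ x) xx⁻¹≈1) ⟩
    1# * z         ≈⟨ *-identityˡ z ⟩
    z              ∎

  xy≈0⇒y≈0 : ∀ {x y} → x ≉ 0# → x * y ≈ 0# → y ≈ 0#
  xy≈0⇒y≈0 {x} x≉0 xy≈0 = *-cancelˡ-nonZero x≉0 (trans xy≈0 (sym (zeroʳ x)))

  *-nonZero : ∀ {x y} → x ≉ 0# → y ≉ 0# → x * y ≉ 0#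
  *-nonZero x≉0 y≉0 xy≈0 = y≉0 (xy≈0⇒y≈0 x≉0 xy≈0)

  ^-nonZero : ∀ {x} n → x ≉ 0# → x ^ n ≉ 0#
  ^-nonZero zero    x≉0 = 1≉0
  ^-nonZero (suc n) x≉0 = *-nonZero x≉0 (^-nonZero n x≉0)

  x^n≈0⇒x≈0 : ∀ {x} n → x ^ n ≈ 0# → x ≈ 0#
  x^n≈0⇒x≈0 {x} n x^n≈0 = decidable-stable (x ≟ 0#) (λ x≉0 → ^-nonZero n x≉0 x^n≈0)

  0^n≈0 : ∀ n .{{_ : NonZero n}} → 0# ^ n ≈ 0#
  0^n≈0 (suc n) = zeroˡ _

  -- Translation by x permutes E, so the sum of all elements equals itself plus N · x.
  order·x≈0 : ∀ x → N · x ≈ 0#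
  order·x≈0 x = +-cancelˡ (sum from) _ _ (begin
    sum from + N · x             ≈⟨ +-congˡ (sum-replicate N) ⟨
    sum from + sum {N} (λ _ → x) ≈⟨ ∑-distrib-+ from (λ _ → x) ⟨
    sum (λ i → from i + x)       ≈⟨ sum-reindex +-commutativeMonoid (λ y → y) (λ eq → eq) (_+ x) (_- x)
                                      +-congʳ +-congʳ (//-rightDividesˡ x) (//-rightDividesʳ x) ⟨
    sum from                     ≈⟨ +-identityʳ (sum from) ⟨
    sum from + 0#                ∎)

  open CommutativeMonoidSum *-commutativeMonoid
    using () renaming (sum to product; sum-remove to product-remove; sum-cong-≋ to product-cong;
                       sum-replicate to product-replicate; ∑-distrib-+ to product-distrib-*)

  product-nonZero : ∀ {n} (t : Vector Carrier n) → (∀ i → t i ≉ 0#) → product t ≉ 0#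
  product-nonZero {zero}  t t≉0 = 1≉0
  product-nonZero {suc n} t t≉0 = *-nonZero (t≉0 zero) (product-nonZero (t ∘ suc) (t≉0 ∘ suc))

  -- Position `i` will be that of the element 0, which contributes 1 to the product. The outer `a`
  -- fills this gap, so the exponent is the full order of the subfield and not one less.
  a*product≈a^n : ∀ {n a} (t : Vector Carrier n) i → t i ≈ 1# → (∀ j → j ≢ i → t j ≈ a) →
                  a * product t ≈ a ^ n
  a*product≈a^n {suc n} {a} t i tᵢ≈1 tⱼ≈a = *-congˡ (begin
    product t                             ≈⟨ product-remove {i = i} t ⟩
    t i * product (λ j → t (punchIn i j)) ≈⟨ *-cong tᵢ≈1 (product-cong (λ j → tⱼ≈a _ (Fin.punchInᵢ≢i i j))) ⟩
    1# * product {n} (λ _ → a)            ≈⟨ *-identityˡ _ ⟩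
    product {n} (λ _ → a)                 ≈⟨ product-replicate n ⟩
    a ^ n                                 ∎)

  module Subfield {ℓ} {F : Pred Carrier ℓ} {m} (F-subfield : IsSubfieldOfOrder F m) where
    open IsSubfield (proj₁ F-subfield) public
    private module F = FiniteSetoid (proj₂ F-subfield)

    elements : Vector Carrier m
    elements = proj₁ ∘ F.from

    elements∈ : ∀ i → elements i ∈ F
    elements∈ = proj₂ ∘ F.from

    index : ∀ {x} → x ∈ F → Fin m
    index x∈F = F.to (_ , x∈F)

    elements∘index : ∀ {x} (x∈F : x ∈ F) → elements (index x∈F) ≈ x
    elements∘index x∈F = F.from∘to (_ , x∈F)

    elements-injective : ∀ {i j} → elements i ≈ elements j → i ≡ j
    elements-injective = F.from-injective

    _∈? : Decidable F
    x ∈? = map′ (λ (i , eq) → resp eq (elements∈ i)) (λ x∈F → index x∈F , elements∘index x∈F)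
                (Fin.any? (λ i → elements i ≟ x))

    order-nonZero : NonZero m
    order-nonZero = Fin.nonZeroIndex (index 0∈)

    minus-closed : ∀ {x y} → x ∈ F → y ∈ F → x - y ∈ F
    minus-closed x∈F y∈F = +-closed x∈F (-‿closed y∈F)

    -- The product of F∖{0} is invariant under multiplication by a ≉ 0; nonZeroPart and factor
    -- deal with the element 0 so that the products can range over all of F.
    x^order≈x : ∀ {a} → a ∈ F → a ^ m ≈ a
    x^order≈x {a} a∈F with a ≟ 0#
    ... | yes a≈0 = trans (^-congˡ m a≈0) (trans (0^n≈0 m {{order-nonZero}}) (sym a≈0))
    ... | no  a≉0 with a⁻¹ , aa⁻¹≈1 ← inverse a≉0 = begin
      a ^ m                           ≈⟨ a*product≈a^n (factor ∘ elements) (index 0∈) (factor-0 (elements∘index 0∈))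
                                           (λ j j≢0 → factor-≉0 (j≢0 ∘ index-0)) ⟨
      a * product (factor ∘ elements) ≈⟨ *-congˡ product-factor≈1 ⟩
      a * 1#                          ≈⟨ *-identityʳ a ⟩
      a                               ∎
      where
      index-0 : ∀ {j} → elements j ≈ 0# → j ≡ index 0∈
      index-0 eⱼ≈0 = elements-injective (trans eⱼ≈0 (sym (elements∘index 0∈)))
      select : Carrier → Carrier → Carrier
      select y x with x ≟ 0#
      ... | yes _ = 1#
      ... | no  _ = y
      factor : Carrier → Carrier
      factor = select a
      nonZeroPart : Carrier → Carrier
      nonZeroPart x = select x x
      factor-0 : ∀ {x} → x ≈ 0# → factor x ≈ 1#
      factor-0 {x} x≈0 with x ≟ 0#
      ... | yes _   = refl
      ... | no  x≉0 = contradiction x≈0 x≉0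
      factor-≉0 : ∀ {x} → x ≉ 0# → factor x ≈ a
      factor-≉0 {x} x≉0 with x ≟ 0#
      ... | yes x≈0 = contradiction x≈0 x≉0
      ... | no  _   = refl
      nonZeroPart-cong : ∀ {x y} → x ≈ y → nonZeroPart x ≈ nonZeroPart y
      nonZeroPart-cong {x} {y} x≈y with x ≟ 0# | y ≟ 0#
      ... | yes _   | yes _   = refl
      ... | yes x≈0 | no  y≉0 = contradiction (trans (sym x≈y) x≈0) y≉0
      ... | no  x≉0 | yes y≈0 = contradiction (trans x≈y y≈0) x≉0
      ... | no  _   | no  _   = x≈y
      nonZeroPart≉0 : ∀ x → nonZeroPart x ≉ 0#
      nonZeroPart≉0 x with x ≟ 0#
      ... | yes _   = 1≉0
      ... | no  x≉0 = x≉0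
      nonZeroPart-* : ∀ x → nonZeroPart (a * x) ≈ factor x * nonZeroPart x
      nonZeroPart-* x with x ≟ 0# | (a * x) ≟ 0#
      ... | yes _   | yes _    = sym (*-identityˡ 1#)
      ... | yes x≈0 | no  ax≉0 = contradiction (trans (*-congˡ x≈0) (zeroʳ a)) ax≉0
      ... | no  x≉0 | yes ax≈0 = contradiction (xy≈0⇒y≈0 a≉0 ax≈0) x≉0
      ... | no  _   | no  _    = refl
      a⁻¹∈F : a⁻¹ ∈ F
      a⁻¹∈F = ⁻¹-closed a∈F aa⁻¹≈1
      cancel : ∀ {x y} z → x * y ≈ 1# → x * (y * z) ≈ z
      cancel {x} {y} z xy≈1 = trans (sym (*-assoc x y z)) (trans (*-congʳ xy≈1) (*-identityˡ z))
      P = product (nonZeroPart ∘ elements)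
      product-factor≈1 : product (factor ∘ elements) ≈ 1#
      product-factor≈1 = *-cancelˡ-nonZero (product-nonZero _ (nonZeroPart≉0 ∘ elements)) (begin
        P * product (factor ∘ elements)                            ≈⟨ *-comm P _ ⟩
        product (factor ∘ elements) * P                            ≈⟨ product-distrib-* (factor ∘ elements) _ ⟨
        product (λ i → factor (elements i) * nonZeroPart (elements i)) ≈⟨ product-cong (nonZeroPart-* ∘ elements) ⟨
        product (λ i → nonZeroPart (a * elements i))
          ≈⟨ F.sum-reindex *-commutativeMonoid (nonZeroPart ∘ proj₁) nonZeroPart-cong
               (λ (x , x∈F) → a * x , *-closed a∈F x∈F) (λ (x , x∈F) → a⁻¹ * x , *-closed a⁻¹∈F x∈F)
               *-congˡ *-congˡ (λ (x , _) → cancel x aa⁻¹≈1)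
               (λ (x , _) → cancel x (trans (*-comm a⁻¹ a) aa⁻¹≈1)) ⟨
        P                                                          ≈⟨ *-identityʳ P ⟨
        P * 1#                                                     ∎)

  -- Characteristic and additivity of Frobenius powers

  p^n·1≈[p·1]^n : ∀ p n → (p ℕ.^ n) · 1# ≈ (p · 1#) ^ n
  p^n·1≈[p·1]^n p zero    = ×-homo-1 1#
  p^n·1≈[p·1]^n p (suc n) = trans (×1-homo-* p (p ℕ.^ n)) (*-congˡ (p^n·1≈[p·1]^n p n))

  -- N · 1 vanishes and is the n-th power of p · 1, and a field has no nonzero nilpotents.
  order≡p^n⇒p·1≈0 : ∀ p n → N ≡ p ℕ.^ n → p · 1# ≈ 0#
  order≡p^n⇒p·1≈0 p n N≡p^n = x^n≈0⇒x≈0 n (begin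
    (p · 1#) ^ n      ≈⟨ p^n·1≈[p·1]^n p n ⟨
    (p ℕ.^ n) · 1#    ≈⟨ ·-congˡ N≡p^n ⟨
    N · 1#            ≈⟨ order·x≈0 1# ⟩
    0#                ∎)

  sum-ends : ∀ {n} (t : Vector Carrier (suc (suc n))) →
             (∀ i → toℕ i ≢ 0 → toℕ i ≢ suc n → t i ≈ 0#) → sum t ≈ t zero + t (fromℕ (suc n))
  sum-ends {n} t interior≈0 = +-congˡ (begin
    sum (t ∘ suc)                                   ≈⟨ sum-init-last (t ∘ suc) ⟩
    sum (λ i → t (suc (inject₁ i))) + t (suc (fromℕ n))
      ≈⟨ +-congʳ (sum-cong-≋ (λ i → interior≈0 (suc (inject₁ i)) (λ ()) (ℕ.<⇒≢ (s≤s (inject₁< i))))) ⟩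
    sum {n} (λ _ → 0#) + t (suc (fromℕ n))          ≈⟨ +-congʳ (sum-replicate-zero n) ⟩
    0# + t (suc (fromℕ n))                          ≈⟨ +-identityˡ _ ⟩
    t (suc (fromℕ n))                               ∎)
    where
    inject₁< : ∀ i → toℕ (inject₁ i) < n
    inject₁< i = ≡.subst (_< n) (≡.sym (Fin.toℕ-inject₁ i)) (Fin.toℕ<n i)

  ^-+-interior≈0 : ∀ {n} → 1 < n → (∀ {k} → 0 < k → k < n → ∀ z → (n C k) · z ≈ 0#) →
                   ∀ x y → (x + y) ^ n ≈ x ^ n + y ^ n
  ^-+-interior≈0 {suc (suc n)} (s≤s (s≤s _)) interior≈0 x y = begin
    (x + y) ^ m                    ≈⟨ binomial-theorem m x y ⟩
    sum term                       ≈⟨ sum-ends term (λ i i≢0 i≢m → interior≈0 (ℕ.n≢0⇒n>0 i≢0)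
                                        (ℕ.≤∧≢⇒< (Fin.toℕ≤pred[n] i) i≢m) _) ⟩
    term zero + term (fromℕ m)     ≈⟨ +-cong first last ⟩
    y ^ m + x ^ m                  ≈⟨ +-comm (y ^ m) (x ^ m) ⟩
    x ^ m + y ^ m                  ∎
    where
    m = suc (suc n)
    term : Vector Carrier (suc m)
    term = binomialTerm x y m
    first : term zero ≈ y ^ m
    first = trans (×-homo-1 _) (*-identityˡ (y ^ m))
    last : term (fromℕ m) ≈ x ^ m
    last rewrite Fin.toℕ-fromℕ n | nCn≡1 m | ℕ.n∸n≡0 n =
      trans (×-homo-1 _) (*-identityʳ (x ^ m))

  module Characteristic {p} (p-prime : Prime p) (p·1≈0 : p · 1# ≈ 0#) where

    p∣n⇒n·x≈0 : ∀ {n} → p ∣ n → ∀ x → n · x ≈ 0#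
    p∣n⇒n·x≈0 {n} (divides k n≡kp) x = begin
      n · x                     ≈⟨ ·-congʳ n (*-identityˡ x) ⟨
      n · (1# * x)              ≈⟨ ×-assoc-* n 1# x ⟨
      (n · 1#) * x              ≈⟨ *-congʳ (·-congˡ n≡kp) ⟩
      ((k ℕ.* p) · 1#) * x      ≈⟨ *-congʳ (×1-homo-* k p) ⟩
      ((k · 1#) * (p · 1#)) * x ≈⟨ *-congʳ (*-congˡ p·1≈0) ⟩
      ((k · 1#) * 0#) * x       ≈⟨ *-congʳ (zeroʳ _) ⟩
      0# * x                    ≈⟨ zeroˡ x ⟩
      0#                        ∎

    ^p-+ : ∀ x y → (x + y) ^ p ≈ x ^ p + y ^ p
    ^p-+ = ^-+-interior≈0 (ℕ.nonTrivial⇒n>1 p {{prime⇒nonTrivial p-prime}})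
      (λ 0<k k<p → p∣n⇒n·x≈0 (prime∣C p-prime 0<k k<p))

  -- Applied in a tower: from p to q = p^k, from q to r = q^s, and from r to r^i.
  ^-+-iterate : ∀ {r} → (∀ x y → (x + y) ^ r ≈ x ^ r + y ^ r) →
                ∀ j x y → (x + y) ^ (r ℕ.^ j) ≈ x ^ (r ℕ.^ j) + y ^ (r ℕ.^ j)
  ^-+-iterate     ^r-+ zero    x y = distribʳ 1# x y
  ^-+-iterate {r} ^r-+ (suc j) x y = begin
    (x + y) ^ (r ℕ.* r ℕ.^ j)                   ≈⟨ ^-assocʳ (x + y) r (r ℕ.^ j) ⟨
    ((x + y) ^ r) ^ (r ℕ.^ j)                   ≈⟨ ^-congˡ (r ℕ.^ j) (^r-+ x y) ⟩
    (x ^ r + y ^ r) ^ (r ℕ.^ j)                 ≈⟨ ^-+-iterate ^r-+ j (x ^ r) (y ^ r) ⟩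
    (x ^ r) ^ (r ℕ.^ j) + (y ^ r) ^ (r ℕ.^ j)   ≈⟨ +-cong (^-assocʳ x r (r ℕ.^ j)) (^-assocʳ y r (r ℕ.^ j)) ⟩
    x ^ (r ℕ.* r ℕ.^ j) + y ^ (r ℕ.* r ℕ.^ j)   ∎

  -- An additive map with trivial kernel: additivity gives (x - y)^r = 0.
  ^-injective : ∀ r → (∀ x y → (x + y) ^ r ≈ x ^ r + y ^ r) → ∀ {x y} → x ^ r ≈ y ^ r → x ≈ y
  ^-injective r ^r-+ {x} {y} x^r≈y^r = x∙y⁻¹≈ε⇒x≈y x y (x^n≈0⇒x≈0 r (+-cancelˡ (y ^ r) _ _ (begin
    y ^ r + (x - y) ^ r  ≈⟨ ^r-+ y (x - y) ⟨
    (y + (x - y)) ^ r    ≈⟨ ^-congˡ r (y+[x-y]≈x x y) ⟩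
    x ^ r                ≈⟨ x^r≈y^r ⟩
    y ^ r                ≈⟨ +-identityʳ (y ^ r) ⟨
    y ^ r + 0#           ∎)))

  -- Roots of monic polynomials

  -- A vector of length n lists the non-leading coefficients, constant term first, of a monic
  -- polynomial of degree n.
  ⟦_⟧ : ∀ {n} → Vec Carrier n → Carrier → Carrier
  ⟦ []     ⟧ x = 1#
  ⟦ c ∷ cs ⟧ x = c + x * ⟦ cs ⟧ x

  -- Synthetic division by X - r: the coefficients are the partial values of Horner's scheme, and
  -- the leading 1 stays implicit.
  quotient : ∀ {n} → Vec Carrier (suc n) → Carrier → Vec Carrier n
  quotient (c ∷ [])          r = []
  quotient (c ∷ cs@(_ ∷ _)) r = ⟦ cs ⟧ r ∷ quotient cs r

  -- Division by X - r with remainder. The point is written r + d in place of x so that no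
  -- subtraction occurs and the semiring solver applies.
  factor-theorem : ∀ {n} (cs : Vec Carrier (suc n)) r d →
                   ⟦ cs ⟧ (r + d) ≈ ⟦ cs ⟧ r + d * ⟦ quotient cs r ⟧ (r + d)
  factor-theorem (c ∷ []) r d =
    solve 4 (λ c r d u → c :+ (r :+ d) :* u := (c :+ r :* u) :+ d :* u) refl c r d 1#
  factor-theorem (c ∷ cs@(_ ∷ _)) r d = begin
    c + (r + d) * ⟦ cs ⟧ (r + d)     ≈⟨ +-congˡ (*-congˡ (factor-theorem cs r d)) ⟩
    c + (r + d) * (e + d * q)        ≈⟨ solve 5 (λ c r d e q → c :+ (r :+ d) :* (e :+ d :* q) :=
                                          (c :+ r :* e) :+ d :* (e :+ (r :+ d) :* q)) refl c r d e q ⟩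
    (c + r * e) + d * (e + (r + d) * q) ∎
    where
    e = ⟦ cs ⟧ r
    q = ⟦ quotient cs r ⟧ (r + d)

  ⟦⟧-cong : ∀ {n} (cs : Vec Carrier n) {x y} → x ≈ y → ⟦ cs ⟧ x ≈ ⟦ cs ⟧ y
  ⟦⟧-cong []       x≈y = refl
  ⟦⟧-cong (c ∷ cs) x≈y = +-congˡ (*-cong x≈y (⟦⟧-cong cs x≈y))

  -- Divide out the first root: every other one differs from it, hence is a root of the quotient. In
  -- degree 0 the polynomial is the constant 1.
  ¬excessRoots : ∀ {n} (cs : Vec Carrier n) (r : Vector Carrier (suc n)) →
                 (∀ {i j} → r i ≈ r j → i ≡ j) → ¬ (∀ i → ⟦ cs ⟧ (r i) ≈ 0#)
  ¬excessRoots []          r r-injective root = 1≉0 (root zero)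
  ¬excessRoots cs@(_ ∷ _) r r-injective root =
    ¬excessRoots (quotient cs r₀) (r ∘ suc) (Fin.suc-injective ∘ r-injective) λ i →
      let d = r (suc i) - r₀ in
      xy≈0⇒y≈0 (λ d≈0 → Fin.0≢1+n (≡.sym (r-injective (x∙y⁻¹≈ε⇒x≈y _ _ d≈0)))) (begin
        d * ⟦ quotient cs r₀ ⟧ (r (suc i))  ≈⟨ *-congˡ (⟦⟧-cong (quotient cs r₀) (y+[x-y]≈x (r (suc i)) r₀)) ⟨
        d * ⟦ quotient cs r₀ ⟧ (r₀ + d)     ≈⟨ +-identityˡ _ ⟨
        0# + d * ⟦ quotient cs r₀ ⟧ (r₀ + d) ≈⟨ +-congʳ (root zero) ⟨
        ⟦ cs ⟧ r₀ + d * ⟦ quotient cs r₀ ⟧ (r₀ + d) ≈⟨ factor-theorem cs r₀ d ⟨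
        ⟦ cs ⟧ (r₀ + d)                     ≈⟨ ⟦⟧-cong cs (y+[x-y]≈x (r (suc i)) r₀) ⟩
        ⟦ cs ⟧ (r (suc i))                  ≈⟨ root (suc i) ⟩
        0#                                  ∎)
    where r₀ = r zero

  ⟦replicate-0⟧ : ∀ n x → ⟦ Vec.replicate n 0# ⟧ x ≈ x ^ n
  ⟦replicate-0⟧ zero    x = refl
  ⟦replicate-0⟧ (suc n) x = trans (+-identityˡ _) (*-congˡ (⟦replicate-0⟧ n x))

  -- Fixed points are roots of X^m - X, which is monic of degree m precisely because 1 < m; for m =
  -- 1 it would vanish identically.
  ¬excessFixedPoints : ∀ {m n} → 1 < m → m < n → (r : Vector Carrier n) →
                       (∀ {i j} → r i ≈ r j → i ≡ j) → ¬ (∀ i → r i ^ m ≈ r i)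
  ¬excessFixedPoints {suc (suc m)} (s≤s (s≤s _)) m<n r r-injective fixed =
    -- After matching, the exponent is m + 2, and the list holds the m + 2 coefficients below the
    -- leading one. `inject` keeps just one point more than the degree.
    ¬excessRoots (0# ∷ - 1# ∷ Vec.replicate m 0#) (r ∘ inject) (inject-injective ∘ r-injective) (root ∘ inject)
    where
    inject = λ i → inject≤ i m<n
    inject-injective : ∀ {i j} → inject i ≡ inject j → i ≡ j
    inject-injective = Fin.inject≤-injective m<n m<n _ _
    root : ∀ i → ⟦ 0# ∷ - 1# ∷ Vec.replicate m 0# ⟧ (r i) ≈ 0#
    root i = begin
      0# + x * (- 1# + x * ⟦ Vec.replicate m 0# ⟧ x) ≈⟨ +-identityˡ _ ⟩
      x * (- 1# + x * ⟦ Vec.replicate m 0# ⟧ x)      ≈⟨ *-congˡ (+-congˡ (*-congˡ (⟦replicate-0⟧ m x))) ⟩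
      x * (- 1# + x * x ^ m)                         ≈⟨ distribˡ x (- 1#) _ ⟩
      x * - 1# + x ^ suc (suc m)                     ≈⟨ +-congˡ (fixed i) ⟩
      x * - 1# + x                                   ≈⟨ +-congʳ (-‿distribʳ-* x 1#) ⟨
      - (x * 1#) + x                                 ≈⟨ +-congʳ (-‿cong (*-identityʳ x)) ⟩
      - x + x                                        ≈⟨ -‿inverseˡ x ⟩
      0#                                             ∎
      where x = r i

  module _ {ℓ} {F : Pred Carrier ℓ} {m} (F-subfield : IsSubfieldOfOrder F m) where
    open Subfield F-subfield

    -- The m elements of F are already roots of X^m - X; an x outside F would be one root too many.
    x^order≈x⇒x∈F : 1 < m → ∀ {x} → x ^ m ≈ x → x ∈ F
    x^order≈x⇒x∈F 1<m {x} x^m≈x with x ∈?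
    ... | yes x∈F = x∈F
    ... | no  x∉F = contradiction fixed
      (¬excessFixedPoints 1<m ℕ.≤-refl (x ∷ᵛ elements) (λ {i} {j} → injective i j))
      where
      x≉element : ∀ {i} → x ≉ elements i
      x≉element {i} x≈eᵢ = x∉F (resp (sym x≈eᵢ) (elements∈ i))
      injective : ∀ i j → (x ∷ᵛ elements) i ≈ (x ∷ᵛ elements) j → i ≡ j
      injective zero    zero    _  = ≡.refl
      injective zero    (suc j) eq = contradiction eq x≉element
      injective (suc i) zero    eq = contradiction (sym eq) x≉element
      injective (suc i) (suc j) eq = ≡.cong suc (elements-injective eq)
      fixed : ∀ i → (x ∷ᵛ elements) i ^ m ≈ (x ∷ᵛ elements) i
      fixed zero    = x^m≈x
      fixed (suc i) = x^order≈x (elements∈ i)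

    -- X^k - X has too few roots to vanish on all of F. With k = q^(j-i) this yields the elements
    -- that separate two characters of L.
    ∃-unfixed : ∀ {k} → 1 < k → k < m → ∃ λ x → x ∈ F × x ^ k ≉ x
    ∃-unfixed {k} 1<k k<m with Fin.all? (λ i → elements i ^ k ≟ elements i)
    ... | yes fixed = contradiction fixed (¬excessFixedPoints 1<k k<m elements elements-injective)
    ... | no ¬fixed with i , eᵢ^k≉eᵢ ← Fin.¬∀⟶∃¬ m _ (λ i → elements i ^ k ≟ elements i) ¬fixed =
      elements i , elements∈ i , eᵢ^k≉eᵢ

  ^-∈ : ∀ {ℓ} {F : Pred Carrier ℓ} → IsSubfield F → ∀ {x} n → x ∈ F → x ^ n ∈ F
  ^-∈ F-subfield zero    x∈F = IsSubfield.1∈ F-subfield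
  ^-∈ F-subfield (suc n) x∈F = IsSubfield.*-closed F-subfield x∈F (^-∈ F-subfield n x∈F)

  1^n≈1 : ∀ n → 1# ^ n ≈ 1#
  1^n≈1 zero    = refl
  1^n≈1 (suc n) = trans (*-identityˡ _) (1^n≈1 n)

  x+y≈y⇒x≈0 : ∀ {x y} → x + y ≈ y → x ≈ 0#
  x+y≈y⇒x≈0 {x} {y} x+y≈y = +-cancelʳ y x 0# (trans x+y≈y (sym (+-identityˡ y)))

  linear : ∀ {d} → Vector Carrier d → Vector Carrier d → Carrier
  linear {d} a v = ∑[ i < d ] (a i * v i)

  linear-+ : ∀ {d} (a b v : Vector Carrier d) → linear (λ i → a i + b i) v ≈ linear a v + linear b v
  linear-+ a b v = trans (sum-cong-≋ (λ i → distribʳ (v i) (a i) (b i))) (∑-distrib-+ (λ i → a i * v i) _)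

  linear-* : ∀ {d} x (a v : Vector Carrier d) → linear (λ i → x * a i) v ≈ x * linear a v
  linear-* x a v = trans (sum-cong-≋ (λ i → *-assoc x (a i) (v i))) (sym (*-distribˡ-sum x (λ i → a i * v i)))

  linear-0 : ∀ {d} {a : Vector Carrier d} → (∀ i → a i ≈ 0#) → ∀ v → linear a v ≈ 0#
  linear-0 {d} a≈0 v = trans (sum-cong-≋ (λ i → trans (*-congʳ (a≈0 i)) (zeroˡ (v i)))) (sum-replicate-zero d)

  linear-minus≈0 : ∀ {d} (a b v : Vector Carrier d) → linear a v ≈ linear b v →
                   linear (λ i → a i - b i) v ≈ 0#
  linear-minus≈0 a b v a·v≈b·v = x+y≈y⇒x≈0 (begin
    linear (λ i → a i - b i) v + linear b v ≈⟨ linear-+ (λ i → a i - b i) b v ⟨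
    linear (λ i → (a i - b i) + b i) v      ≈⟨ sum-cong-≋ (λ i → *-congʳ (//-rightDividesˡ (b i) (a i))) ⟩
    linear a v                              ≈⟨ a·v≈b·v ⟩
    linear b v                              ∎)

  -- Linear algebra over a subfield

  record IsSubspace {ℓ ℓ′} (F : Pred Carrier ℓ) (U : Pred Carrier ℓ′) : Set (c ⊔ ℓ₁ ⊔ ℓ ⊔ ℓ′) where
    field
      resp     : U Respects _≈_
      0∈       : 0# ∈ U
      +-closed : ∀ {x y} → x ∈ U → y ∈ U → x + y ∈ U
      *-closed : ∀ {a x} → a ∈ F → x ∈ U → a * x ∈ U

    sum-closed : ∀ {n} {t : Vector Carrier n} → (∀ i → t i ∈ U) → sum t ∈ U
    sum-closed {zero}  t∈U = 0∈
    sum-closed {suc n} t∈U = +-closed (t∈U zero) (sum-closed (t∈U ∘ suc))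

  module OverSubfield {ℓ} {F : Pred Carrier ℓ} {m} (F-subfield : IsSubfieldOfOrder F m) where
    open Subfield F-subfield

    Span : ∀ {d} → Vector Carrier d → Pred Carrier (c ⊔ ℓ₁ ⊔ ℓ)
    Span {d} v x = ∃ λ (a : Vector Carrier d) → (∀ i → a i ∈ F) × x ≈ linear a v

    Independent : ∀ {d} → Vector Carrier d → Set (c ⊔ ℓ₁ ⊔ ℓ)
    Independent {d} v = (a : Vector Carrier d) → (∀ i → a i ∈ F) → linear a v ≈ 0# → ∀ i → a i ≈ 0#

    module Subspace {ℓ′} {U : Pred Carrier ℓ′} (U-subspace : IsSubspace F U) where
      open IsSubspace U-subspace public renaming
        (resp to U-resp; 0∈ to 0∈U; +-closed to U-+-closed; *-closed to U-*-closed; sum-closed to U-sum-closed)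

      +-cancelʳ-∈ : ∀ {x y} → y ∈ U → x + y ∈ U → x ∈ U
      +-cancelʳ-∈ {x} {y} y∈U x+y∈U = U-resp (begin
        (x + y) + - 1# * y    ≈⟨ +-congˡ (-‿distribˡ-* 1# y) ⟨
        (x + y) + - (1# * y)  ≈⟨ +-congˡ (-‿cong (*-identityˡ y)) ⟩
        (x + y) - y           ≈⟨ //-rightDividesʳ y x ⟩
        x                     ∎) (U-+-closed x+y∈U (U-*-closed (-‿closed 1∈) y∈U))

      *-cancelˡ-∈ : ∀ {a x} → a ∈ F → a ≉ 0# → a * x ∈ U → x ∈ U
      *-cancelˡ-∈ {a} {x} a∈F a≉0 ax∈U with a⁻¹ , aa⁻¹≈1 ← inverse a≉0 = U-resp (begin
        a⁻¹ * (a * x)  ≈⟨ *-assoc a⁻¹ a x ⟨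
        (a⁻¹ * a) * x  ≈⟨ *-congʳ (trans (*-comm a⁻¹ a) aa⁻¹≈1) ⟩
        1# * x         ≈⟨ *-identityˡ x ⟩
        x              ∎) (U-*-closed (⁻¹-closed a∈F aa⁻¹≈1) ax∈U)

      Span⊆ : ∀ {d} {v : Vector Carrier d} → (∀ i → v i ∈ U) → ∀ {x} → x ∈ Span v → x ∈ U
      Span⊆ v∈U (a , a∈F , x≈a·v) = U-resp (sym x≈a·v) (U-sum-closed (λ i → U-*-closed (a∈F i) (v∈U i)))

    Span-isSubspace : ∀ {d} (v : Vector Carrier d) → IsSubspace F (Span v)
    Span-isSubspace v = record
      { resp     = λ x≈y (a , a∈F , x≈a·v) → a , a∈F , trans (sym x≈y) x≈a·v
      ; 0∈       = (λ _ → 0#) , (λ _ → 0∈) , sym (linear-0 (λ _ → refl) v)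
      ; +-closed = λ (a , a∈F , x≈a·v) (b , b∈F , y≈b·v) →
          (λ i → a i + b i) , (λ i → +-closed (a∈F i) (b∈F i)) ,
          trans (+-cong x≈a·v y≈b·v) (sym (linear-+ a b v))
      ; *-closed = λ {k} k∈F (a , a∈F , x≈a·v) →
          (λ i → k * a i) , (λ i → *-closed k∈F (a∈F i)) ,
          trans (*-congˡ x≈a·v) (sym (linear-* k a v))
      }

    Span-tail : ∀ {d} (v : Vector Carrier (suc d)) {x} → x ∈ Span (v ∘ suc) → x ∈ Span v
    Span-tail v (a , a∈F , x≈a·v) =
      0# ∷ᵛ a , (λ { zero → 0∈ ; (suc i) → a∈F i }) ,
      trans x≈a·v (sym (trans (+-congʳ (zeroˡ (v zero))) (+-identityˡ _)))

    v∈Span : ∀ {d} (v : Vector Carrier d) i → v i ∈ Span v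
    v∈Span v zero    = 1# ∷ᵛ (λ _ → 0#) , (λ { zero → 1∈ ; (suc i) → 0∈ }) , sym (begin
      1# * v zero + linear (λ _ → 0#) (v ∘ suc)  ≈⟨ +-cong (*-identityˡ (v zero)) (linear-0 (λ _ → refl) (v ∘ suc)) ⟩
      v zero + 0#                                ≈⟨ +-identityʳ (v zero) ⟩
      v zero                                     ∎)
    v∈Span v (suc i) = Span-tail v (v∈Span (v ∘ suc) i)

    -- F is finite, so every candidate for the first coefficient can be tried, with recursion on the
    -- remaining vectors.
    Span? : ∀ {d} (v : Vector Carrier d) → Decidable (Span v)
    Span? {zero}  v x = map′ (λ x≈0 → (λ ()) , (λ ()) , x≈0) (λ (_ , _ , x≈0) → x≈0) (x ≟ 0#)
    Span? {suc d} v x = map′ to-Span from-Span (Fin.any? (λ i → Span? (v ∘ suc) (x - elements i * v zero)))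
      where
      to-Span : ∃ (λ i → x - elements i * v zero ∈ Span (v ∘ suc)) → x ∈ Span v
      to-Span (i , a , a∈F , x-ev≈a·v) = elements i ∷ᵛ a , (λ { zero → elements∈ i ; (suc i) → a∈F i }) ,
        trans (sym (y+[x-y]≈x x _)) (+-congˡ x-ev≈a·v)
      from-Span : x ∈ Span v → ∃ (λ i → x - elements i * v zero ∈ Span (v ∘ suc))
      from-Span (a , a∈F , x≈a·v) = i , a ∘ suc , a∈F ∘ suc , +-cancelˡ (elements i * v zero) _ _ (begin
        elements i * v zero + (x - elements i * v zero)      ≈⟨ y+[x-y]≈x x _ ⟩
        x                                                    ≈⟨ x≈a·v ⟩
        a zero * v zero + linear (a ∘ suc) (v ∘ suc)         ≈⟨ +-congʳ (*-congʳ (elements∘index (a∈F zero))) ⟨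
        elements i * v zero + linear (a ∘ suc) (v ∘ suc)     ∎)
        where i = index (a∈F zero)

    Independent-tail : ∀ {d} {v : Vector Carrier (suc d)} → Independent v → Independent (v ∘ suc)
    Independent-tail {v = v} v-independent a a∈F a·v≈0 i =
      v-independent (0# ∷ᵛ a) (λ { zero → 0∈ ; (suc i) → a∈F i })
        (trans (+-cong (zeroˡ (v zero)) a·v≈0) (+-identityˡ 0#)) (suc i)

    Independent-∷ : ∀ {d x} {v : Vector Carrier d} → Independent v → ¬ x ∈ Span v → Independent (x ∷ᵛ v)
    Independent-∷ {x = x} {v} v-independent x∉Span a a∈F a·xv≈0 with a zero ≟ 0#
    ... | yes a₀≈0 = λ
      { zero    → a₀≈0
      ; (suc i) → v-independent (a ∘ suc) (a∈F ∘ suc) (begin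
          linear (a ∘ suc) v               ≈⟨ +-identityˡ _ ⟨
          0# + linear (a ∘ suc) v          ≈⟨ +-congʳ (trans (*-congʳ a₀≈0) (zeroˡ x)) ⟨
          a zero * x + linear (a ∘ suc) v  ≈⟨ a·xv≈0 ⟩
          0#                               ∎) i
      }
    ... | no a₀≉0 = contradiction (*-cancelˡ-∈ (a∈F zero) a₀≉0 a₀x∈Span) x∉Span
      where
      open Subspace (Span-isSubspace v)
      a₀x∈Span : a zero * x ∈ Span v
      a₀x∈Span = +-cancelʳ-∈ (a ∘ suc , a∈F ∘ suc , refl) (U-resp (sym a·xv≈0) 0∈U)

    -- Greedy selection: an entry of `x` is kept if it lies in W but not in the span of those kept
    -- from the tail. Run on the enumeration of all of E, this yields a basis of W.
    basisOf : ∀ {ℓ′} {W : Pred Carrier ℓ′} → Decidable W → ∀ {k} (x : Vector Carrier k) →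
              ∃[ d ] ∃ λ (v : Vector Carrier d) →
              Independent v × (∀ i → v i ∈ W) × (∀ i → x i ∈ W → x i ∈ Span v)
    basisOf W? {zero} x = 0 , (λ ()) , (λ _ _ _ ()) , (λ ()) , (λ ())
    basisOf W? {suc k} x with basisOf W? (x ∘ suc) | W? (x zero)
    ... | d , v , v-independent , v∈W , spans | no x₀∉W =
      d , v , v-independent , v∈W , λ { zero x₀∈W → contradiction x₀∈W x₀∉W ; (suc i) → spans i }
    ... | d , v , v-independent , v∈W , spans | yes x₀∈W with Span? v (x zero)
    ...   | yes x₀∈Span = d , v , v-independent , v∈W , λ { zero _ → x₀∈Span ; (suc i) → spans i }
    ...   | no  x₀∉Span = suc d , xv , Independent-∷ v-independent x₀∉Span ,
      (λ { zero → x₀∈W ; (suc i) → v∈W i }) ,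
      λ { zero _ → v∈Span xv zero ; (suc i) xᵢ∈W → Span-tail xv (spans i xᵢ∈W) }
      where xv = x zero ∷ᵛ v

    ∃-basis : ∀ {ℓ′} {W : Pred Carrier ℓ′} → IsSubspace F W → Decidable W → ∃[ d ] HasDimension F W d
    ∃-basis {W = W} W-subspace W? with d , v , v-independent , v∈W , spans ← basisOf W? from =
      d , v , record
        { independent = v-independent
        ; spanning    = λ x → mk⇔ (W⊆Span x) (Span⊆ v∈W)
        }
      where
      open Subspace W-subspace
      W⊆Span : ∀ x → x ∈ W → x ∈ Span v
      W⊆Span x x∈W = IsSubspace.resp (Span-isSubspace v) (from∘to x)
        (spans (to x) (U-resp (sym (from∘to x)) x∈W))

    -- Distinct coefficient tuples have distinct combinations in E. `finToFun` decodes an index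
    -- below m^d as such a tuple.
    independent⇒m^d≤order : ∀ {d} {v : Vector Carrier d} → Independent v → m ℕ.^ d ≤ N
    independent⇒m^d≤order {d} {v} v-independent = Fin.injective⇒≤ {f = to ∘ combination} λ {i} {j} eq →
      ≡.trans (≡.sym (Fin.funToFin-finToFin {d} i)) (≡.trans
        (funToFin-cong (λ k → elements-injective (x∙y⁻¹≈ε⇒x≈y _ _
          (v-independent _ (λ k → minus-closed (elements∈ _) (elements∈ _))
            (linear-minus≈0 (coefficients i) (coefficients j) v (to-injective eq)) k))))
        (Fin.funToFin-finToFin {d} j))
      where
      coefficients : Fin (m ℕ.^ d) → Vector Carrier d
      coefficients i = elements ∘ finToFun i
      combination : Fin (m ℕ.^ d) → Carrier
      combination i = linear (coefficients i) v
      funToFin-cong : ∀ {k l} {g h : Fin k → Fin l} → (∀ i → g i ≡ h i) → funToFin g ≡ funToFin h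
      funToFin-cong {zero}  g≗h = ≡.refl
      funToFin-cong {suc k} g≗h = ≡.cong₂ combine (g≗h zero) (funToFin-cong (g≗h ∘ suc))

    -- Each element is recovered from the coefficients chosen for it, so this choice is injective.
    spanning⇒order≤m^d : ∀ {d} {v : Vector Carrier d} → (∀ x → x ∈ Span v) → N ≤ m ℕ.^ d
    spanning⇒order≤m^d {d} {v} spans = Fin.injective⇒≤ {f = code} λ {i} {j} eq → from-injective (begin
      from i                        ≈⟨ combination∘code i ⟨
      combination (code i)          ≡⟨ ≡.cong combination eq ⟩
      combination (code j)          ≈⟨ combination∘code j ⟩
      from j                        ∎)
      where
      combination : Fin (m ℕ.^ d) → Carrier
      combination i = linear (elements ∘ finToFun i) v
      code : Fin N → Fin (m ℕ.^ d)
      code i = let _ , a∈F , _ = spans (from i) in funToFin (index ∘ a∈F)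
      combination∘code : ∀ i → combination (code i) ≈ from i
      combination∘code i with a , a∈F , x≈a·v ← spans (from i) = trans
        (sum-cong-≋ (λ k → *-congʳ (trans (reflexive (≡.cong elements (Fin.finToFun-funToFin (index ∘ a∈F) k)))
                                            (elements∘index (a∈F k)))))
        (sym x≈a·v)

    -- Artin's elimination argument for independence of characters, carried out modulo a subspace.
    characters-independent :
      ∀ {ℓ′} {U : Pred Carrier ℓ′} → IsSubspace F U →
      ∀ {k} (e : Vector ℕ k) → (∀ i j → toℕ i < toℕ j → ∃ λ x → x ∈ F × x ^ e i ≉ x ^ e j) →
      (w : Vector Carrier k) → (∀ {x} → x ∈ F → linear (λ i → x ^ e i) w ∈ U) → ∀ i → w i ∈ U
    characters-independent {U = U} U-subspace {suc k} e distinct w sum∈U = λ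
      { zero → head∈U ; (suc i) → tail∈U i }
      where
      open Subspace U-subspace
      difference : Carrier → Fin k → Carrier
      difference y i = y ^ e (suc i) - y ^ e zero
      difference∈F : ∀ {y} → y ∈ F → ∀ i → difference y i ∈ F
      difference∈F y∈F i =
        minus-closed (^-∈ (proj₁ F-subfield) (e (suc i)) y∈F) (^-∈ (proj₁ F-subfield) (e zero) y∈F)
      -- Evaluating the relation at xy and subtracting y^(e 0) times its value at x cancels the
      -- first term. It is stated as a sum, ready for `+-cancelʳ-∈`.
      eliminate : ∀ x y → linear (λ i → x ^ e (suc i)) (λ i → difference y i * w (suc i))
                          + y ^ e zero * linear (λ i → x ^ e i) w
                          ≈ linear (λ i → (x * y) ^ e i) w
      eliminate x y = begin
        linear xᵉ dw + y₀ * (x ^ e zero * w zero + linear xᵉ (w ∘ suc))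
          ≈⟨ solve 5 (λ l y₀ x₀ w₀ l′ → l :+ y₀ :* (x₀ :* w₀ :+ l′) := (x₀ :* y₀) :* w₀ :+ (l :+ y₀ :* l′))
               refl (linear xᵉ dw) y₀ (x ^ e zero) (w zero) (linear xᵉ (w ∘ suc)) ⟩
        (x ^ e zero * y₀) * w zero + (linear xᵉ dw + y₀ * linear xᵉ (w ∘ suc))
          ≈⟨ +-cong (*-congʳ (sym (^-distrib-* x y (e zero))))
                    (+-congˡ (*-distribˡ-sum y₀ (λ i → xᵉ i * w (suc i)))) ⟩
        (x * y) ^ e zero * w zero + (linear xᵉ dw + sum (λ i → y₀ * (xᵉ i * w (suc i))))
          ≈⟨ +-congˡ (∑-distrib-+ (λ i → xᵉ i * dw i) (λ i → y₀ * (xᵉ i * w (suc i)))) ⟨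
        (x * y) ^ e zero * w zero + sum (λ i → xᵉ i * dw i + y₀ * (xᵉ i * w (suc i)))
          ≈⟨ +-congˡ (sum-cong-≋ term) ⟩
        linear (λ i → (x * y) ^ e i) w ∎
        where
        y₀ = y ^ e zero
        xᵉ dw : Vector Carrier k
        xᵉ i = x ^ e (suc i)
        dw i = difference y i * w (suc i)
        term : ∀ i → xᵉ i * dw i + y₀ * (xᵉ i * w (suc i)) ≈ (x * y) ^ e (suc i) * w (suc i)
        term i = begin
          xᵉ i * dw i + y₀ * (xᵉ i * w (suc i))
            ≈⟨ solve 4 (λ x d w y₀ → x :* (d :* w) :+ y₀ :* (x :* w) := (x :* (y₀ :+ d)) :* w)
                 refl (xᵉ i) (difference y i) (w (suc i)) y₀ ⟩
          (xᵉ i * (y₀ + difference y i)) * w (suc i)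
            ≈⟨ *-congʳ (*-congˡ (y+[x-y]≈x (y ^ e (suc i)) y₀)) ⟩
          (xᵉ i * y ^ e (suc i)) * w (suc i)
            ≈⟨ *-congʳ (^-distrib-* x y (e (suc i))) ⟨
          (x * y) ^ e (suc i) * w (suc i) ∎
      tail∈U : ∀ i → w (suc i) ∈ U
      -- This y separates the first character from the one at `suc i`, and perhaps from no other;
      -- the induction hypothesis is therefore used at index i alone, with a new y for each i.
      tail∈U i with y , y∈F , yᵉ⁰≉yᵉⁱ ← distinct zero (suc i) (s≤s z≤n) =
        *-cancelˡ-∈ (difference∈F y∈F i) (λ d≈0 → yᵉ⁰≉yᵉⁱ (sym (x∙y⁻¹≈ε⇒x≈y _ _ d≈0)))
          (characters-independent U-subspace (e ∘ suc) (λ i j i<j → distinct (suc i) (suc j) (s≤s i<j))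
            (λ i → difference y i * w (suc i))
            (λ {x} x∈F → +-cancelʳ-∈ (U-*-closed (^-∈ (proj₁ F-subfield) (e zero) y∈F) (sum∈U x∈F))
              (U-resp (sym (eliminate x y)) (sum∈U (*-closed x∈F y∈F)))) i)
      head∈U : w zero ∈ U
      -- At x = 1 the relation is the plain sum of the w's, whose tail already lies in U.
      head∈U = U-resp (trans (*-congʳ (1^n≈1 (e zero))) (*-identityˡ (w zero)))
        (+-cancelʳ-∈ (U-sum-closed (λ i → U-*-closed (^-∈ (proj₁ F-subfield) (e (suc i)) 1∈) (tail∈U i)))
          (sum∈U 1∈))

  -- Exponents j with x^(q^j) = x

  x^[q^i]^[q^j]≈x^q^[i+j] : ∀ q x i j → (x ^ (q ℕ.^ i)) ^ (q ℕ.^ j) ≈ x ^ (q ℕ.^ (i ℕ.+ j))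
  x^[q^i]^[q^j]≈x^q^[i+j] q x i j =
    trans (^-assocʳ x (q ℕ.^ i) (q ℕ.^ j)) (^-congʳ x (≡.sym (ℕ.^-distribˡ-+-* q i j)))

  module _ (q : ℕ) {x : Carrier} where

    q-fixed : ℕ → Set ℓ₁
    q-fixed j = x ^ (q ℕ.^ j) ≈ x

    q-fixed-+ : ∀ i {j} → q-fixed i → q-fixed j → q-fixed (i ℕ.+ j)
    q-fixed-+ i {j} fixedᵢ fixedⱼ =
      trans (sym (x^[q^i]^[q^j]≈x^q^[i+j] q x i j)) (trans (^-congˡ (q ℕ.^ j) fixedᵢ) fixedⱼ)

    q-fixed-∸ : ∀ i {j} → q-fixed i → q-fixed (i ℕ.+ j) → q-fixed j
    q-fixed-∸ i {j} fixedᵢ fixedᵢ₊ⱼ =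
      trans (^-congˡ (q ℕ.^ j) (sym fixedᵢ)) (trans (x^[q^i]^[q^j]≈x^q^[i+j] q x i j) fixedᵢ₊ⱼ)

    q-fixed-* : ∀ m {j} → q-fixed j → q-fixed (m ℕ.* j)
    q-fixed-* zero    {j} fixedⱼ = *-identityʳ x
    q-fixed-* (suc m) {j} fixedⱼ = q-fixed-+ j fixedⱼ (q-fixed-* m fixedⱼ)

    -- The fixing exponents are closed under sums and differences, and Bézout's identity scaled by e
    -- writes e as a difference of multiples of se and ne. The case e = 1 gives the fixed field, e =
    -- j - i the distinctness of characters.
    q-fixed-coprime : ∀ s n e → gcd s n ≡ 1 → q-fixed (s ℕ.* e) → q-fixed n → q-fixed e
    q-fixed-coprime s n e gcd≡1 fixed-se fixed-n =
      bézout (≡.subst (λ g → Identity g s n) gcd≡1 (identity (gcd-GCD s n)))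
      where
      fixed-ne : q-fixed (n ℕ.* e)
      fixed-ne = ≡.subst q-fixed (ℕ.*-comm e n) (q-fixed-* e fixed-n)
      scale : ∀ i j {m l} → 1 ℕ.+ j ℕ.* l ≡ i ℕ.* m → i ℕ.* (m ℕ.* e) ≡ j ℕ.* (l ℕ.* e) ℕ.+ e
      scale i j {m} {l} 1+jl≡im = ≡.trans (≡.sym (ℕ.*-assoc i m e)) (≡.trans (≡.cong (ℕ._* e) (≡.sym 1+jl≡im))
        (≡.trans (ℕ.+-comm e _) (≡.cong (ℕ._+ e) (ℕ.*-assoc j l e))))
      bézout : Identity 1 s n → q-fixed e
      bézout (+- i j 1+jn≡is) = q-fixed-∸ (j ℕ.* (n ℕ.* e)) {e} (q-fixed-* j fixed-ne)
        (≡.subst q-fixed (scale i j 1+jn≡is) (q-fixed-* i fixed-se))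
      bézout (-+ i j 1+is≡jn) = q-fixed-∸ (i ℕ.* (s ℕ.* e)) {e} (q-fixed-* i fixed-se)
        (≡.subst q-fixed (scale j i 1+is≡jn) (q-fixed-* j fixed-ne))

  IsBasis-resp-≐ : ∀ {ℓ ℓ′ ℓ″ d} {F : Pred Carrier ℓ} {W : Pred Carrier ℓ′} {W′ : Pred Carrier ℓ″}
                   {v : Vector Carrier d} → W ≐ W′ → IsBasis F W v → IsBasis F W′ v
  IsBasis-resp-≐ (W⊆W′ , W′⊆W) v-basis = record
    { independent = IsBasis.independent v-basis
    ; spanning    = λ x → mk⇔ (Equivalence.to (IsBasis.spanning v-basis x) ∘ W′⊆W)
                              (W⊆W′ ∘ Equivalence.from (IsBasis.spanning v-basis x))
    }

  -- Galois descent

  Fix : Endo → Pred Carrier ℓ₁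
  Fix T x = T x ≈ x

  module Semilinear {ℓL} {L : Pred Carrier ℓL} {l} (L-subfield : IsSubfieldOfOrder L l) (r : ℕ) (T : Endo)
    (T-cong : ∀ {x y} → x ≈ y → T x ≈ T y)
    (T-+ : ∀ x y → T (x + y) ≈ T x + T y)
    (T-* : ∀ {a} → a ∈ L → ∀ x → T (a * x) ≈ a ^ r * T x)
    where

    T-0 : T 0# ≈ 0#
    T-0 = x+y≈y⇒x≈0 (trans (sym (T-+ 0# 0#)) (T-cong (+-identityˡ 0#)))

    T-sum : ∀ {m} (t : Vector Carrier m) → T (sum t) ≈ sum (T ∘ t)
    T-sum {zero}  t = T-0
    T-sum {suc m} t = trans (T-+ (t zero) _) (+-congˡ (T-sum (t ∘ suc)))

    T^-cong : ∀ j {x y} → x ≈ y → (T ^∘ j) x ≈ (T ^∘ j) y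
    T^-cong zero    x≈y = x≈y
    T^-cong (suc j) x≈y = T-cong (T^-cong j x≈y)

    T^-+ : ∀ j x y → (T ^∘ j) (x + y) ≈ (T ^∘ j) x + (T ^∘ j) y
    T^-+ zero    x y = refl
    T^-+ (suc j) x y = trans (T-cong (T^-+ j x y)) (T-+ _ _)

    T^-0 : ∀ j → (T ^∘ j) 0# ≈ 0#
    T^-0 zero    = refl
    T^-0 (suc j) = trans (T-cong (T^-0 j)) T-0

    T^-* : ∀ j {a} → a ∈ L → ∀ x → (T ^∘ j) (a * x) ≈ a ^ (r ℕ.^ j) * (T ^∘ j) x
    T^-* zero    {a} a∈L x = *-congʳ (sym (*-identityʳ a))
    T^-* (suc j) {a} a∈L x = begin
      T ((T ^∘ j) (a * x))                    ≈⟨ T-cong (T^-* j a∈L x) ⟩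
      T (a ^ (r ℕ.^ j) * (T ^∘ j) x)          ≈⟨ T-* (^-∈ (proj₁ L-subfield) (r ℕ.^ j) a∈L) _ ⟩
      (a ^ (r ℕ.^ j)) ^ r * T ((T ^∘ j) x)    ≈⟨ *-congʳ (^-assocʳ a (r ℕ.^ j) r) ⟩
      a ^ (r ℕ.^ j ℕ.* r) * T ((T ^∘ j) x)    ≡⟨ ≡.cong (λ e → a ^ e * T ((T ^∘ j) x)) (ℕ.*-comm (r ℕ.^ j) r) ⟩
      a ^ (r ℕ.^ suc j) * T ((T ^∘ j) x)      ∎

    Fix⊆Fix-T^ : ∀ j {x} → x ∈ Fix T → x ∈ Fix (T ^∘ j)
    Fix⊆Fix-T^ zero    Tx≈x = refl
    Fix⊆Fix-T^ (suc j) Tx≈x = trans (T-cong (Fix⊆Fix-T^ j Tx≈x)) Tx≈x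

    -- Serves twice: Fix T over K with j = 1, and Fix Tⁿ over L with j = n.
    Fix-isSubspace : ∀ {ℓF} {F : Pred Carrier ℓF} j → (∀ {a} → a ∈ F → a ∈ L × a ^ (r ℕ.^ j) ≈ a) →
                     IsSubspace F (Fix (T ^∘ j))
    Fix-isSubspace j F⊆Lʳ = record
      { resp     = λ x≈y Tx≈x → trans (T^-cong j (sym x≈y)) (trans Tx≈x x≈y)
      ; 0∈       = T^-0 j
      ; +-closed = λ Tx≈x Ty≈y → trans (T^-+ j _ _) (+-cong Tx≈x Ty≈y)
      ; *-closed = λ a∈F Tx≈x → let a∈L , aʳ≈a = F⊆Lʳ a∈F in
                   trans (T^-* j a∈L _) (*-cong aʳ≈a Tx≈x)
      }

    trace : ℕ → Carrier → Carrier
    trace n x = ∑[ j < n ] ((T ^∘ toℕ j) x)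

    -- T shifts the summands by one and Tⁿx = x closes the cycle. Adding x to both sides reduces
    -- this to splitting the sum of n + 1 summands at its first or at its last term.
    trace∈Fix : ∀ n {x} → x ∈ Fix (T ^∘ n) → trace n x ∈ Fix T
    trace∈Fix n {x} Tⁿx≈x = +-cancelˡ x _ _ (begin
      x + T (trace n x)                                  ≈⟨ +-congˡ (T-sum {n} (λ j → (T ^∘ toℕ j) x)) ⟩
      trace (suc n) x                                    ≈⟨ sum-init-last {n} (λ j → (T ^∘ toℕ j) x) ⟩
      sum {n} (λ j → (T ^∘ toℕ (inject₁ j)) x) + (T ^∘ toℕ (fromℕ n)) x
        ≈⟨ +-cong (sum-cong-≋ {n} (λ j → reflexive (≡.cong (λ i → (T ^∘ i) x) (Fin.toℕ-inject₁ j))))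
                  (reflexive (≡.cong (λ i → (T ^∘ i) x) (Fin.toℕ-fromℕ n))) ⟩
      trace n x + (T ^∘ n) x                             ≈⟨ +-congˡ Tⁿx≈x ⟩
      trace n x + x                                      ≈⟨ +-comm (trace n x) x ⟩
      x + trace n x                                      ∎)

    module Descent {ℓK} {K : Pred Carrier ℓK} {k} (K-subfield : IsSubfieldOfOrder K k)
      (K⊆L : ∀ {x} → x ∈ K → x ∈ L)
      (fixed⇒∈K : ∀ {x} → x ∈ L → x ^ r ≈ x → x ∈ K)
      where
      private
        module K = OverSubfield K-subfield
        module L = OverSubfield L-subfield
        module L-subfield = Subfield L-subfield

      -- A relation normalised to γ₀ ≈ 1 gives, by applying T and subtracting, the shorter relation with
      -- coefficients γᵢʳ - γᵢ; these vanish by induction, so all γᵢ lie in K.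
      K-independent⇒L-independent : ∀ {d} {v : Vector Carrier d} → (∀ i → v i ∈ Fix T) →
                                    K.Independent v → L.Independent v
      K-independent⇒L-independent {zero} v∈Fix v-independent a a∈L a·v≈0 ()
      K-independent⇒L-independent {suc d} {v} v∈Fix v-independent a a∈L a·v≈0 with a zero ≟ 0#
      ... | yes a₀≈0 = λ
        { zero    → a₀≈0
        ; (suc i) → K-independent⇒L-independent (v∈Fix ∘ suc) (K.Independent-tail {v = v} v-independent)
            (a ∘ suc) (a∈L ∘ suc)
            (begin
              linear (a ∘ suc) (v ∘ suc)                   ≈⟨ +-identityˡ _ ⟨
              0# + linear (a ∘ suc) (v ∘ suc)              ≈⟨ +-congʳ (trans (*-congʳ a₀≈0) (zeroˡ (v zero))) ⟨
              linear a v                                   ≈⟨ a·v≈0 ⟩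
              0#                                           ∎) i
        }
      ... | no a₀≉0 with a₀⁻¹ , a₀a₀⁻¹≈1 ← inverse a₀≉0 =
        contradiction (trans (sym γ₀≈1) (v-independent γ γ∈K γ·v≈0 zero)) 1≉0
        where
        γ : Vector Carrier (suc d)
        γ i = a₀⁻¹ * a i
        γ∈L : ∀ i → γ i ∈ L
        γ∈L i = L-subfield.*-closed (L-subfield.⁻¹-closed (a∈L zero) a₀a₀⁻¹≈1) (a∈L i)
        γ₀≈1 : γ zero ≈ 1#
        γ₀≈1 = trans (*-comm a₀⁻¹ (a zero)) a₀a₀⁻¹≈1
        γ·v≈0 : linear γ v ≈ 0#
        γ·v≈0 = trans (linear-* a₀⁻¹ a v) (trans (*-congˡ a·v≈0) (zeroʳ a₀⁻¹))
        γʳ·v≈0 : linear (λ i → γ i ^ r) v ≈ 0#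
        γʳ·v≈0 = begin
          linear (λ i → γ i ^ r) v             ≈⟨ sum-cong-≋ (λ i → trans (T-* (γ∈L i) (v i)) (*-congˡ (v∈Fix i))) ⟨
          sum (λ i → T (γ i * v i))            ≈⟨ T-sum (λ i → γ i * v i) ⟨
          T (linear γ v)                       ≈⟨ T-cong γ·v≈0 ⟩
          T 0#                                 ≈⟨ T-0 ⟩
          0#                                   ∎
        γ₀ʳ≈γ₀ : γ zero ^ r ≈ γ zero
        γ₀ʳ≈γ₀ = trans (^-congˡ r γ₀≈1) (trans (1^n≈1 r) (sym γ₀≈1))
        Δ : Vector Carrier (suc d)
        Δ i = γ i ^ r - γ i
        Δ·v≈0 : linear (Δ ∘ suc) (v ∘ suc) ≈ 0#
        Δ·v≈0 = begin
          linear (Δ ∘ suc) (v ∘ suc)        ≈⟨ +-identityˡ _ ⟨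
          0# + linear (Δ ∘ suc) (v ∘ suc)   ≈⟨ +-congʳ (trans (*-congʳ (x≈y⇒x∙y⁻¹≈ε γ₀ʳ≈γ₀)) (zeroˡ (v zero))) ⟨
          linear Δ v                        ≈⟨ linear-minus≈0 (λ i → γ i ^ r) γ v (trans γʳ·v≈0 (sym γ·v≈0)) ⟩
          0#                                ∎
        Δ∈L : ∀ i → Δ i ∈ L
        Δ∈L i = L-subfield.minus-closed (^-∈ (proj₁ L-subfield) r (γ∈L i)) (γ∈L i)
        γʳ≈γ : ∀ i → γ i ^ r ≈ γ i
        γʳ≈γ zero    = γ₀ʳ≈γ₀
        γʳ≈γ (suc i) = x∙y⁻¹≈ε⇒x≈y _ _ (K-independent⇒L-independent
          (v∈Fix ∘ suc) (K.Independent-tail {v = v} v-independent) (Δ ∘ suc) (Δ∈L ∘ suc) Δ·v≈0 i)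
        γ∈K : ∀ i → γ i ∈ K
        γ∈K i = fixed⇒∈K (γ∈L i) (γʳ≈γ i)

      -- For v fixed by Tⁿ and every a ∈ L, trace (a v) = Σⱼ a^(rʲ) Tʲ v lies in Fix T; independence
      -- of the characters a ↦ a^(rʲ) modulo the span of a basis of Fix T then puts v itself there.
      basis-descent : ∀ n .{{_ : NonZero n}} → (∀ {x} → x ∈ L → x ^ (r ℕ.^ n) ≈ x) →
                      (∀ {i j} → i < j → j < n → ∃ λ x → x ∈ L × x ^ (r ℕ.^ i) ≉ x ^ (r ℕ.^ j)) →
                      ∀ {d} {v : Vector Carrier d} → IsBasis K (Fix T) v → IsBasis L (Fix (T ^∘ n)) v
      basis-descent (suc n-1) Lʳⁿ≈L distinct {v = v} v-basis = record
        { independent = K-independent⇒L-independent v∈Fix (IsBasis.independent v-basis)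
        ; spanning    = λ x → mk⇔ Fix⊆Span (Span⊆ (Fix⊆Fix-T^ n ∘ v∈Fix))
        }
        where
        n = suc n-1
        open L.Subspace (Fix-isSubspace n (λ a∈L → a∈L , Lʳⁿ≈L a∈L))
        v∈Fix : ∀ i → v i ∈ Fix T
        v∈Fix i = Equivalence.from (IsBasis.spanning v-basis (v i)) (K.v∈Span v i)
        Fix-T⊆Span : ∀ {x} → x ∈ Fix T → x ∈ L.Span v
        Fix-T⊆Span {x} Tx≈x = let a , a∈K , x≈a·v = Equivalence.to (IsBasis.spanning v-basis x) Tx≈x in
          a , K⊆L ∘ a∈K , x≈a·v
        Fix⊆Span : ∀ {x} → x ∈ Fix (T ^∘ n) → x ∈ L.Span v
        Fix⊆Span {x} Tⁿx≈x = L.characters-independent (L.Span-isSubspace v) {n} (λ j → r ℕ.^ toℕ j)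
          (λ i j i<j → distinct i<j (Fin.toℕ<n j)) (λ j → (T ^∘ toℕ j) x)
          (λ {a} a∈L → IsSubspace.resp (L.Span-isSubspace v)
            (sum-cong-≋ {n} (λ j → T^-* (toℕ j) a∈L x))
            (Fix-T⊆Span (trace∈Fix n (U-*-closed a∈L Tⁿx≈x))))
          -- The summand with j = 0 carries the vector T⁰x = x; this index exists because n is
          -- positive.
          zero

-- The operator `G ∘ σ` and the dimension counts

m^i≤m^j⇒i≤j : ∀ {m i j} → 1 < m → m ℕ.^ i ≤ m ℕ.^ j → i ≤ j
m^i≤m^j⇒i≤j {m} {i} {j} 1<m mⁱ≤mʲ = ℕ.≮⇒≥ (λ j<i → ℕ.<⇒≱ (ℕ.^-monoʳ-< m 1<m j<i) mⁱ≤mʲ)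

theorem1p5 :
    ∀ {c ℓ₁ ℓ₂ ℓK ℓL} (q n t s : ℕ) .{{_ : NonZero n}} .{{_ : NonZero t}} .{{_ : NonZero s}} →
    IsPrimePower q → gcd s n ≡ 1 →
    (E : HeytingField c ℓ₁ ℓ₂) → let open FieldTheory E in
    HasOrder setoid (q ℕ.^ (n ℕ.* t)) →
    (K : Pred Carrier ℓK) → IsSubfieldOfOrder K q →
    (L : Pred Carrier ℓL) → IsSubfieldOfOrder L (q ℕ.^ n) →
    (b : Vector Carrier t) →
    let ker-f = ker (f q n s b)
        Φ     = (G q n b ∘ σ q s) ^∘ n
        ker-Φ = ker (λ x → Φ x - x)
    in  (∃[ d ] d ≤ t × HasDimension K ker-f d)
      × ((ker-f ≐ (λ x → x ≈ 0#)) ⇔ (ker-Φ ≐ (λ x → x ≈ 0#)))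
      × (∃[ d ] HasDimension K ker-f d × HasDimension L ker-Φ d)
      × (HasDimension K ker-f t ⇔ (∀ x → Φ x ≈ x))
theorem1p5 {ℓ₁ = ℓ₁} q n t s (p , k , p-prime , 1≤k , ≡.refl) gcd≡1 E order K K-subfield L L-subfield b =
  (d , d≤t , v , K-basis) ,
  mk⇔ (λ (ker-f⊆0 , _) → ker-Φ⊆0 ker-f⊆0 , 0⊆ker-Φ) (λ (ker-Φ⊆0 , _) → ker-Φ⊆0 ∘ ker-f⊆ker-Φ , 0⊆ker-f) ,
  (d , (v , K-basis) , v , L-basis) ,
  mk⇔ (λ (u , u-basis) → t-dimensional⇒Φ≈id u-basis)
      (λ Φ≈id → ≡.subst (HasDimension K ker-f) (d≡t Φ≈id) (v , K-basis))
  where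
  1<q : 1 < q
  1<q = ℕ.^-monoʳ-< p (ℕ.nonTrivial⇒n>1 p {{prime⇒nonTrivial p-prime}}) 1≤k
  1<q^ : ∀ {j} → 0 < j → 1 < q ℕ.^ j
  1<q^ 0<j = ℕ.^-monoʳ-< q 1<q 0<j
  1<q^n : 1 < q ℕ.^ n
  1<q^n = 1<q^ (ℕ.>-nonZero⁻¹ n)
  1<order : 1 < q ℕ.^ (n ℕ.* t)
  1<order = 1<q^ (ℕ.>-nonZero⁻¹ _ {{ℕ.m*n≢0 n t}})

  open FiniteField E 1<order order
  module K = OverSubfield K-subfield
  module L = OverSubfield L-subfield

  ^q-+ : ∀ x y → (x + y) ^ q ≈ x ^ q + y ^ q
  ^q-+ = ^-+-iterate (Characteristic.^p-+ p-prime
    (order≡p^n⇒p·1≈0 p (k ℕ.* (n ℕ.* t)) (ℕ.^-*-assoc p k (n ℕ.* t)))) k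

  r : ℕ
  r = q ℕ.^ s
  T Φ : Endo
  T = G q n b ∘ σ q s
  Φ = T ^∘ n
  ker-f ker-Φ : Pred Carrier ℓ₁
  ker-f = ker (f q n s b)
  ker-Φ = ker (λ x → Φ x - x)

  L-q-fixed : ∀ {x} → x ∈ L → x ^ (q ℕ.^ n) ≈ x
  L-q-fixed = Subfield.x^order≈x L-subfield

  q^1≡q : q ℕ.^ 1 ≡ q
  q^1≡q = ℕ.*-identityʳ q

  K-q-fixed : ∀ j {x} → x ∈ K → x ^ (q ℕ.^ j) ≈ x
  K-q-fixed j {x} x∈K = ≡.subst (q-fixed q) (ℕ.*-identityʳ j)
    (q-fixed-* q j (trans (^-congʳ x q^1≡q) (Subfield.x^order≈x K-subfield x∈K)))

  -- Iterating x^q = x gives x^(q^n) = x, and L contains every root of this equation in E.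
  K⊆L : ∀ {x} → x ∈ K → x ∈ L
  K⊆L x∈K = x^order≈x⇒x∈F L-subfield 1<q^n (K-q-fixed n x∈K)

  fixed⇒∈K : ∀ {x} → x ∈ L → x ^ r ≈ x → x ∈ K
  fixed⇒∈K {x} x∈L xʳ≈x = x^order≈x⇒x∈F K-subfield 1<q (trans (^-congʳ x (≡.sym q^1≡q))
    (q-fixed-coprime q s n 1 gcd≡1 (≡.subst (q-fixed q) (≡.sym (ℕ.*-identityʳ s)) xʳ≈x) (L-q-fixed x∈L)))

  r-power : ∀ j x → x ^ (r ℕ.^ j) ≈ x ^ (q ℕ.^ (s ℕ.* j))
  r-power j x = ^-congʳ x (ℕ.^-*-assoc q s j)

  Lʳⁿ≈L : ∀ {x} → x ∈ L → x ^ (r ℕ.^ n) ≈ x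
  Lʳⁿ≈L {x} x∈L = trans (r-power n x) (q-fixed-* q s (L-q-fixed x∈L))

  -- Cancelling the injective power r^i from an equality of the two values leaves x fixed by
  -- q^(s(j-i)). Together with q^n this makes x fixed by q^(j-i), whereas x was chosen not to be, as
  -- 0 < j - i < n allows.
  distinct : ∀ {i j} → i < j → j < n → ∃ λ x → x ∈ L × ¬ x ^ (r ℕ.^ i) ≈ x ^ (r ℕ.^ j)
  distinct {i} {j} i<j j<n
    with x , x∈L , x^q^e≉x ← ∃-unfixed L-subfield (1<q^ (ℕ.m<n⇒0<n∸m i<j))
                               (ℕ.^-monoʳ-< q 1<q (ℕ.≤-<-trans (ℕ.m∸n≤m j i) j<n)) =
    x , x∈L , λ xʳⁱ≈xʳʲ → x^q^e≉x (q-fixed-coprime q s n (j ℕ.∸ i) gcd≡1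
      (trans (sym (r-power (j ℕ.∸ i) x)) (sym (^-injective (r ℕ.^ i) (^-+-iterate (^-+-iterate ^q-+ s) i) (begin
        x ^ (r ℕ.^ i)                            ≈⟨ xʳⁱ≈xʳʲ ⟩
        x ^ (r ℕ.^ j)                            ≡⟨ ≡.cong (λ m → x ^ (r ℕ.^ m)) (ℕ.m∸n+n≡m (ℕ.<⇒≤ i<j)) ⟨
        x ^ (r ℕ.^ (j ℕ.∸ i ℕ.+ i))              ≈⟨ x^[q^i]^[q^j]≈x^q^[i+j] r x (j ℕ.∸ i) i ⟨
        (x ^ (r ℕ.^ (j ℕ.∸ i))) ^ (r ℕ.^ i)      ∎))))
      (L-q-fixed x∈L))

  e : Fin t → ℕ
  e i = q ℕ.^ (n ℕ.* toℕ i)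

  T-cong : ∀ {x y} → x ≈ y → T x ≈ T y
  T-cong x≈y = sum-cong-≋ {t} (λ i → *-congˡ (^-congˡ (e i) (^-congˡ r x≈y)))

  T-+ : ∀ x y → T (x + y) ≈ T x + T y
  T-+ x y = begin
    T (x + y)  ≈⟨ sum-cong-≋ {t} (λ i → *-congˡ (trans (^-congˡ (e i) (^-+-iterate ^q-+ s x y))
                                                    (^-+-iterate ^q-+ (n ℕ.* toℕ i) (x ^ r) (y ^ r)))) ⟩
    sum {t} (λ i → b i * ((x ^ r) ^ e i + (y ^ r) ^ e i))
               ≈⟨ sum-cong-≋ {t} (λ i → distribˡ (b i) _ _) ⟩
    sum {t} (λ i → b i * (x ^ r) ^ e i + b i * (y ^ r) ^ e i)
               ≈⟨ ∑-distrib-+ {t} (λ i → b i * (x ^ r) ^ e i) (λ i → b i * (y ^ r) ^ e i) ⟩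
    T x + T y  ∎

  T-* : ∀ {a} → a ∈ L → ∀ x → T (a * x) ≈ a ^ r * T x
  T-* {a} a∈L x = begin
    T (a * x)  ≈⟨ sum-cong-≋ {t} (λ i → *-congˡ (trans (^-congˡ (e i) (^-distrib-* a x r))
                                                       (^-distrib-* (a ^ r) (x ^ r) (e i)))) ⟩
    sum {t} (λ i → b i * ((a ^ r) ^ e i * (x ^ r) ^ e i))
               ≈⟨ sum-cong-≋ {t} (λ i → trans (sym (*-assoc (b i) _ _)) (trans (*-congʳ (*-comm (b i) _))
                    (trans (*-assoc _ (b i) _) (*-congʳ (aʳ-fixed i))))) ⟩
    sum {t} (λ i → a ^ r * (b i * (x ^ r) ^ e i))
               ≈⟨ *-distribˡ-sum {t} (a ^ r) (λ i → b i * (x ^ r) ^ e i) ⟨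
    a ^ r * T x  ∎
    where
    aʳ-fixed : ∀ i → (a ^ r) ^ e i ≈ a ^ r
    aʳ-fixed i = ≡.subst (q-fixed q) (ℕ.*-comm (toℕ i) n)
      (q-fixed-* q (toℕ i) (L-q-fixed (^-∈ (proj₁ L-subfield) r a∈L)))

  open Semilinear L-subfield r T T-cong T-+ T-*
  open Descent K-subfield K⊆L fixed⇒∈K

  f≈-x+T : ∀ x → f q n s b x ≈ - x + T x
  f≈-x+T x = +-congˡ (sum-cong-≋ {t} (λ i → *-congˡ (sym (x^[q^i]^[q^j]≈x^q^[i+j] q x s (n ℕ.* toℕ i)))))

  Fix-T≐ker-f : Fix T ≐ ker-f
  Fix-T≐ker-f =
    (λ {x} Tx≈x → trans (f≈-x+T x) (trans (+-congˡ Tx≈x) (-‿inverseˡ x))) ,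
    (λ {x} fx≈0 → +-cancelˡ (- x) _ _ (trans (sym (f≈-x+T x)) (trans fx≈0 (sym (-‿inverseˡ x)))))

  Fix-Φ≐ker-Φ : Fix Φ ≐ ker-Φ
  Fix-Φ≐ker-Φ = x≈y⇒x∙y⁻¹≈ε , x∙y⁻¹≈ε⇒x≈y _ _

  descend : ∀ {d} {v : Vector Carrier d} → IsBasis K (Fix T) v → IsBasis L (Fix Φ) v
  descend = basis-descent n Lʳⁿ≈L distinct

  ∃-Fix-basis : ∃[ d ] HasDimension K (Fix T) d
  ∃-Fix-basis = K.∃-basis
    (Fix-isSubspace 1 (λ x∈K → K⊆L x∈K , trans (r-power 1 _) (K-q-fixed (s ℕ.* 1) x∈K)))
    (λ x → T x ≟ x)

  d : ℕ
  d = proj₁ ∃-Fix-basis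
  v : Vector Carrier d
  v = proj₁ (proj₂ ∃-Fix-basis)
  Fix-basis : IsBasis K (Fix T) v
  Fix-basis = proj₂ (proj₂ ∃-Fix-basis)
  K-basis : IsBasis K ker-f v
  K-basis = IsBasis-resp-≐ Fix-T≐ker-f Fix-basis
  L-basis : IsBasis L ker-Φ v
  L-basis = IsBasis-resp-≐ Fix-Φ≐ker-Φ (descend Fix-basis)

  L-independent⇒≤t : ∀ {i} {u : Vector Carrier i} → L.Independent u → i ≤ t
  L-independent⇒≤t {i} {u} u-independent = m^i≤m^j⇒i≤j 1<q^n
    (≡.subst ((q ℕ.^ n) ℕ.^ i ≤_) (≡.sym (ℕ.^-*-assoc q n t)) (L.independent⇒m^d≤order {v = u} u-independent))

  d≤t : d ≤ t
  d≤t = L-independent⇒≤t {u = v} (IsBasis.independent L-basis)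

  -- If Φ is the identity, the L-basis of Fix Φ spans E, so q^(nt) is at most (q^n)^d.
  d≡t : (∀ x → Φ x ≈ x) → d ≡ t
  d≡t Φ≈id = ℕ.≤-antisym d≤t (m^i≤m^j⇒i≤j 1<q^n
    (≡.subst (_≤ (q ℕ.^ n) ℕ.^ d) (≡.sym (ℕ.^-*-assoc q n t))
      (L.spanning⇒order≤m^d (λ x → Equivalence.to (IsBasis.spanning (descend Fix-basis) x) (Φ≈id x)))))

  -- Descent turns `u` into t vectors independent over L; an x outside their span would extend them
  -- to t + 1, above the bound.
  t-dimensional⇒Φ≈id : ∀ {u : Vector Carrier t} → IsBasis K ker-f u → ∀ x → Φ x ≈ x
  t-dimensional⇒Φ≈id {u} u-K-basis x with L.Span? u x | descend (IsBasis-resp-≐ (≐-sym Fix-T≐ker-f) u-K-basis)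
  ... | yes x∈Span | u-L-basis = Equivalence.from (IsBasis.spanning u-L-basis x) x∈Span
  ... | no  x∉Span | u-L-basis = contradiction
    (L-independent⇒≤t {u = x ∷ᵛ u} (L.Independent-∷ (IsBasis.independent u-L-basis) x∉Span)) ℕ.1+n≰n

  ker-f⊆ker-Φ : ∀ {x} → x ∈ ker-f → x ∈ ker-Φ
  ker-f⊆ker-Φ = proj₁ Fix-Φ≐ker-Φ ∘ Fix⊆Fix-T^ n ∘ proj₂ Fix-T≐ker-f

  0⊆ker-f : ∀ {x} → x ≈ 0# → x ∈ ker-f
  0⊆ker-f x≈0 = proj₁ Fix-T≐ker-f (trans (T-cong x≈0) (trans T-0 (sym x≈0)))

  0⊆ker-Φ : ∀ {x} → x ≈ 0# → x ∈ ker-Φ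
  0⊆ker-Φ = ker-f⊆ker-Φ ∘ 0⊆ker-f

  -- The L-basis of `ker-Φ` consists of vectors of `ker-f`, so all of them vanish.
  ker-Φ⊆0 : (∀ {x} → x ∈ ker-f → x ≈ 0#) → ∀ {x} → x ∈ ker-Φ → x ≈ 0#
  ker-Φ⊆0 ker-f⊆0 {x} x∈ker-Φ with a , _ , x≈a·v ← Equivalence.to (IsBasis.spanning L-basis x) x∈ker-Φ = begin
    x            ≈⟨ x≈a·v ⟩
    linear a v   ≈⟨ sum-cong-≋ {d} (λ i → *-congˡ (ker-f⊆0 (v∈ker-f i))) ⟩
    sum {d} (λ i → a i * 0#)  ≈⟨ sum-cong-≋ {d} (λ i → zeroʳ (a i)) ⟩
    sum {d} (λ _ → 0#)        ≈⟨ sum-replicate-zero d ⟩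
    0#           ∎
    where
    v∈ker-f : ∀ i → v i ∈ ker-f
    v∈ker-f i = Equivalence.from (IsBasis.spanning K-basis (v i)) (K.v∈Span v i)
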